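{- Let $n\ge 1$ be an integer, let $v=(x_1,\dots,x_n)\in[-1,1]^n$ be a vector of real numbers, and let $$f_n(v):=\prod_{1\le i\le j\le n}\Big(1-\prod_{k=i}^{j}x_k\Big).$$ Then $$f_n(v)\le 2^{\lfloor\frac{n+1}{2}\rfloor}.$$ Moreover, the maximum is attained at $v$ (that is, $f_n(v)=2^{\lfloor\frac{n+1}{2}\rfloor}$) if and only if every coordinate of $v$ is $0$ or $-1$, no two consecutive coordinates of $v$ are both $-1$, and the number of coordinates of $v$ equal to $-1$ is the greatest possible among all vectors in $\{0,-1\}^n$ having no two consecutive coordinates equal to $-1$.
   Context: $\lfloor x\rfloor$ denotes the floor of the real number $x$. Consecutive coordinates of $v=(x_1,\dots,x_n)$ are $x_t,x_{t+1}$ with $1\le t\le n-1$. -}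

module Defs where

open import Algebra.Apartness.Structures using (IsHeytingField)
open import Algebra.Bundles using (CommutativeRing; Semiring)
import Algebra.Definitions.RawSemiring as RawSemiringDefs
open import Data.Bool.Base using (if_then_else_)
open import Data.Fin.Base using (Fin; toℕ; _≤_)
open import Data.Fin.Properties using (_≤?_)
open import Data.Fin.Subset using (Subset; _∈_; ∣_∣)
open import Data.Nat.Base as ℕ using (ℕ; suc)
open import Data.Product.Base using (_×_; ∃-syntax)
open import Data.Sum.Base using (_⊎_)
open import Data.Vec.Functional using (Vector)
open import Function.Bundles using (_⇔_)
open import Level using (_⊔_) renaming (suc to lsuc)
open import Relation.Binary.Core using (Rel)
open import Relation.Binary.PropositionalEquality.Core using (_≡_)
open import Relation.Binary.Structures using (IsStrictPartialOrder)
open import Relation.Nullary using (¬_; does)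
open import Relation.Nullary.Decidable using (_×-dec_)
open import Relation.Unary using (Pred; Decidable)

-- The field of real numbers, characterised as the Cauchy-complete Archimedean
-- ordered field.  Classically the axioms determine ℝ up to unique isomorphism.
-- They are phrased constructively (the order is cotransitive rather than
-- trichotomous), so that the Bishop reals also satisfy them.
record RealField c ℓ₁ ℓ₂ : Set (lsuc (c ⊔ ℓ₁ ⊔ ℓ₂)) where
  infix  8 -_
  infixl 7 _*_
  infixl 6 _+_
  infix  4 _≈_ _<_ _#_ _≤ᴿ_
  field
    Carrier : Set c
    _≈_     : Rel Carrier ℓ₁
    _<_     : Rel Carrier ℓ₂
    _+_     : Carrier → Carrier → Carrier
    _*_     : Carrier → Carrier → Carrier
    -_      : Carrier → Carrier
    0#      : Carrier
    1#      : Carrier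

  _#_ : Rel Carrier ℓ₂
  x # y = x < y ⊎ y < x

  -- Cotransitivity and tightness of _#_ are part of IsHeytingField; so is
  -- 0# # 1#, because 1# is invertible.
  field
    isHeytingField       : IsHeytingField _≈_ _#_ _+_ _*_ -_ 0# 1#
    isStrictPartialOrder : IsStrictPartialOrder _≈_ _<_
    +-monoˡ-<            : ∀ {x y} z → x < y → x + z < y + z
    *-pos                : ∀ {x y} → 0# < x → 0# < y → 0# < x * y

  open IsHeytingField isHeytingField public
    using (isCommutativeRing; isHeytingCommutativeRing; _-_; tight)

  commutativeRing : CommutativeRing c ℓ₁
  commutativeRing = record { isCommutativeRing = isCommutativeRing }

  open RawSemiringDefs (Semiring.rawSemiring (CommutativeRing.semiring commutativeRing)) public
    using (_^_; product) renaming (_×_ to _·_)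

  IsCauchy : (ℕ → Carrier) → Set (c ⊔ ℓ₂)
  IsCauchy s = ∀ ε → 0# < ε →
    ∃[ N ] (∀ m n → N ℕ.≤ m → N ℕ.≤ n → s m < s n + ε)

  _ConvergesTo_ : (ℕ → Carrier) → Carrier → Set (c ⊔ ℓ₂)
  s ConvergesTo l = ∀ ε → 0# < ε →
    ∃[ N ] (∀ n → N ℕ.≤ n → s n < l + ε × l < s n + ε)

  field
    archimedean : ∀ x → ∃[ n ] (x < n · 1#)
    complete    : ∀ s → IsCauchy s → ∃[ l ] (s ConvergesTo l)

  _≤ᴿ_ : Rel Carrier ℓ₂
  x ≤ᴿ y = ¬ (y < x)

module _ {c ℓ₁ ℓ₂} (ℝ : RealField c ℓ₁ ℓ₂) where
  open RealField ℝ

  ∏ : ∀ {n p} {P : Pred (Fin n) p} → Decidable P → (Fin n → Carrier) → Carrier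
  ∏ P? t = product (λ k → if does (P? k) then t k else 1#)

  segmentProduct : ∀ {n} → Vector Carrier n → Fin n → Fin n → Carrier
  segmentProduct v i j = ∏ (λ k → (i ≤? k) ×-dec (k ≤? j)) v

  f : ∀ {n} → Vector Carrier n → Carrier
  f v = product (λ i → ∏ (i ≤?_) (λ j → 1# - segmentProduct v i j))

  InCube : ∀ {n} → Vector Carrier n → Set ℓ₂
  InCube v = ∀ i → - 1# ≤ᴿ v i × v i ≤ᴿ 1#

  ZeroOrMinusOne : ∀ {n} → Vector Carrier n → Set ℓ₁
  ZeroOrMinusOne v = ∀ i → v i ≈ 0# ⊎ v i ≈ - 1#

  NoConsecutiveMinusOnes : ∀ {n} → Vector Carrier n → Set ℓ₁
  NoConsecutiveMinusOnes v =
    ∀ i j → toℕ j ≡ suc (toℕ i) → ¬ (v i ≈ - 1# × v j ≈ - 1#)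

  -- A relation rather than a function, since _≈_ need not be decidable.
  MinusOneCount : ∀ {n} → Vector Carrier n → ℕ → Set ℓ₁
  MinusOneCount {n} v m =
    ∃[ S ] ((∀ i → (i ∈ S) ⇔ (v i ≈ - 1#)) × ∣ S ∣ ≡ m)

  HasMostMinusOnes : ∀ {n} → Vector Carrier n → Set (c ⊔ ℓ₁)
  HasMostMinusOnes {n} v =
    ∃[ m ] (MinusOneCount v m ×
      (∀ (w : Vector Carrier n) k → ZeroOrMinusOne w →
        NoConsecutiveMinusOnes w → MinusOneCount w k → k ℕ.≤ m))

{-# OPTIONS --safe #-}

-- Put x_k = y_k / y_{k+1}.  The factors are then 1 - y_i / y_j for i < j in
-- N = n + 1 positions, the signs of the y_i decide which factors exceed 1, and
-- the bound 2^⌊N/2⌋ follows by removing one or two positions at a time.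
-- Read the signs as a walk and cut it at the last time of its minimum (of its
-- maximum, if the minimum is last attained at the end).  If the cut is at the
-- start, removing the first position costs a factor at most 1.  Otherwise the
-- two positions next to the cut have opposite signs; let ρ ∈ [-1, 0] be their
-- ratio.  Removing both costs (1 - ρ) ∏ g ρ τ, where τ runs over the ratios of
-- the other positions to the nearer of the two and g ρ τ = (1 - τ)(1 - ρτ).
-- A factor with τ < 0 is cancelled by one with τ > 0 at a nearer position on
-- the same side, and the choice of the cut leaves at most one factor
-- uncancelled, so that the cost is at most (1 - ρ) g ρ u ≤ 2 with u ∈ [-1, 0].
-- Equality forces the ratios of neighbouring positions to be 0 or -1.
--
-- The order is not decidable, but ≤ and ≈ are stable under double negation, so
-- the signs of the finitely many coordinates may be assumed known.

module Submission where

open import Defs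
open import Algebra.Apartness.Structures using (IsHeytingField)
open import Algebra.Bundles using (CommutativeRing)
import Algebra.Properties.CommutativeMonoid.Sum as Sum
import Algebra.Properties.Ring as RingProperties
import Algebra.Properties.Semiring.Mult.TCOptimised as Mult
import Algebra.Solver.Ring as RingSolver
open import Algebra.Solver.Ring.AlmostCommutativeRing
  using (fromCommutativeRing; _-Raw-AlmostCommutative⟶_)
open import Data.Bool.Base using (Bool; true; false; not; _∧_; _xor_; if_then_else_)
open import Data.Bool.Properties using (not-involutive; xor-same; xor-inverseˡ; xor-annihilates-not)
open import Data.Empty using (⊥-elim)
open import Data.Fin.Base using (Fin; zero; suc; toℕ)
open import Data.Fin.Properties using (sequence)
open import Data.Fin.Subset using (Subset; _∈_; ∣_∣; inside; outside)
open import Data.Integer.Base as ℤ using (ℤ; +_; -[1+_]; _⊖_)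
import Data.Integer.Properties as ℤ
open import Data.List.Base using (List; []; _∷_; length; map; _++_; _ʳ++_)
open import Data.List.Properties using (length-map; length-ʳ++; reverse-injective; ʳ++-ʳ++)
open import Data.List.Relation.Unary.All as All using (All; []; _∷_)
import Data.List.Relation.Unary.All.Properties as All
open import Data.List.Relation.Unary.AllPairs as AllPairs using (AllPairs; []; _∷_)
import Data.List.Relation.Unary.AllPairs.Properties as AllPairs
open import Data.List.Relation.Unary.Linked as Linked using (Linked; []; [-]; _∷_)
import Data.List.Relation.Unary.Linked.Properties as Linked
open import Data.Maybe.Base using (just; nothing)
open import Data.Nat.Base as ℕ using (ℕ; zero; suc; z≤n; s≤s; ⌊_/2⌋)
open import Data.Nat.DivMod using (_/_; m/n≡1+[m∸n]/n)
import Data.Nat.Properties as ℕ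
open import Data.Product.Base using (_×_; _,_; proj₁; proj₂; ∃-syntax)
open import Data.Sum.Base using (_⊎_; inj₁; inj₂; [_,_]′)
open import Data.Unit.Polymorphic.Base using (⊤; tt)
open import Data.Vec.Base using (Vec; []; _∷_; here; there)
open import Data.Vec.Functional using (Vector; tail)
open import Data.Vec.Relation.Unary.All as VecAll using ([]; _∷_)
open import Effect.Monad using (RawMonad)
open import Function.Base using (_∘_; flip)
open import Function.Bundles using (_⇔_; mk⇔; Equivalence)
open import Level using (Level; 0ℓ; _⊔_)
open import Relation.Binary.Core using (Rel)
open import Relation.Binary.Definitions using (WeaklyDecidable)
open import Relation.Binary.PropositionalEquality as ≡ using (_≡_)
open import Relation.Binary.Structures using (IsStrictPartialOrder)
open import Relation.Nullary using (¬_; does; yes; no)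
open import Relation.Nullary.Negation using (contradiction; ¬¬-Monad)

-- Ring normalisation with integer coefficients

module IntegerSolver {c ℓ} (R : CommutativeRing c ℓ) where
  open CommutativeRing R
  open Mult semiring using (1+×; ×-homo-+; ×1-homo-*) renaming (_×_ to _·_)
  open RingProperties ring using (-0#≈0#; -‿distribˡ-*; -‿distribʳ-*; -‿involutive; -‿+-comm)
  open import Relation.Binary.Reasoning.Setoid setoid

  ⟦_⟧ : ℤ → Carrier
  ⟦ + n ⟧      = n · 1#
  ⟦ -[1+ n ] ⟧ = - (suc n · 1#)

  neg-homo : ∀ i → ⟦ ℤ.- i ⟧ ≈ - ⟦ i ⟧
  neg-homo (+ zero)  = sym -0#≈0#
  neg-homo (+ suc n) = refl
  neg-homo -[1+ n ]  = sym (-‿involutive _)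

  ⊖-homo : ∀ m n → ⟦ m ⊖ n ⟧ ≈ m · 1# - n · 1#
  ⊖-homo m zero = begin
    m · 1#          ≈⟨ +-identityʳ _ ⟨
    m · 1# + 0#     ≈⟨ +-congˡ -0#≈0# ⟨
    m · 1# - 0#     ∎
  ⊖-homo zero (suc n) = sym (+-identityˡ _)
  ⊖-homo (suc m) (suc n) = begin
    ⟦ suc m ⊖ suc n ⟧                    ≡⟨ ≡.cong ⟦_⟧ (ℤ.[1+m]⊖[1+n]≡m⊖n m n) ⟩
    ⟦ m ⊖ n ⟧                            ≈⟨ ⊖-homo m n ⟩
    m · 1# - n · 1#                      ≈⟨ +-identityˡ _ ⟨
    0# + (m · 1# - n · 1#)               ≈⟨ +-congʳ (-‿inverseʳ 1#) ⟨
    (1# - 1#) + (m · 1# - n · 1#)        ≈⟨ +-assoc _ _ _ ⟩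
    1# + (- 1# + (m · 1# - n · 1#))      ≈⟨ +-congˡ (+-assoc _ _ _) ⟨
    1# + ((- 1# + m · 1#) - n · 1#)      ≈⟨ +-congˡ (+-congʳ (+-comm _ _)) ⟩
    1# + ((m · 1# + - 1#) - n · 1#)      ≈⟨ +-congˡ (+-assoc _ _ _) ⟩
    1# + (m · 1# + (- 1# - n · 1#))      ≈⟨ +-assoc _ _ _ ⟨
    (1# + m · 1#) + (- 1# - n · 1#)      ≈⟨ +-congˡ (-‿+-comm _ _) ⟩
    (1# + m · 1#) - (1# + n · 1#)        ≈⟨ +-cong (1+× m 1#) (-‿cong (1+× n 1#)) ⟨
    suc m · 1# - suc n · 1#              ∎

  +-homo : ∀ i j → ⟦ i ℤ.+ j ⟧ ≈ ⟦ i ⟧ + ⟦ j ⟧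
  +-homo (+ m)    (+ n)    = ×-homo-+ 1# m n
  +-homo (+ m)    -[1+ n ] = ⊖-homo m (suc n)
  +-homo -[1+ m ] (+ n)    = trans (⊖-homo n (suc m)) (+-comm _ _)
  +-homo -[1+ m ] -[1+ n ] = begin
    - (suc (suc (m ℕ.+ n)) · 1#)       ≡⟨ ≡.cong (λ k → - (suc k · 1#)) (ℕ.+-suc m n) ⟨
    - ((suc m ℕ.+ suc n) · 1#)         ≈⟨ -‿cong (×-homo-+ 1# (suc m) (suc n)) ⟩
    - (suc m · 1# + suc n · 1#)        ≈⟨ -‿+-comm _ _ ⟨
    - (suc m · 1#) - suc n · 1#        ∎

  *-homo-pos : ∀ m j → ⟦ + m ℤ.* j ⟧ ≈ m · 1# * ⟦ j ⟧
  *-homo-pos m (+ n) = begin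
    ⟦ + m ℤ.* + n ⟧     ≡⟨ ≡.cong ⟦_⟧ (ℤ.pos-* m n) ⟨
    (m ℕ.* n) · 1#      ≈⟨ ×1-homo-* m n ⟩
    m · 1# * (n · 1#)   ∎
  *-homo-pos m -[1+ n ] = begin
    ⟦ + m ℤ.* -[1+ n ] ⟧         ≡⟨ ≡.cong ⟦_⟧ (ℤ.neg-distribʳ-* (+ m) (+ suc n)) ⟨
    ⟦ ℤ.- (+ m ℤ.* + suc n) ⟧    ≈⟨ neg-homo (+ m ℤ.* + suc n) ⟩
    - ⟦ + m ℤ.* + suc n ⟧        ≈⟨ -‿cong (*-homo-pos m (+ suc n)) ⟩
    - (m · 1# * (suc n · 1#))    ≈⟨ -‿distribʳ-* _ _ ⟩
    m · 1# * - (suc n · 1#)      ∎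

  *-homo : ∀ i j → ⟦ i ℤ.* j ⟧ ≈ ⟦ i ⟧ * ⟦ j ⟧
  *-homo (+ m)    j = *-homo-pos m j
  *-homo -[1+ m ] j = begin
    ⟦ -[1+ m ] ℤ.* j ⟧           ≡⟨ ≡.cong ⟦_⟧ (ℤ.neg-distribˡ-* (+ suc m) j) ⟨
    ⟦ ℤ.- (+ suc m ℤ.* j) ⟧      ≈⟨ neg-homo (+ suc m ℤ.* j) ⟩
    - ⟦ + suc m ℤ.* j ⟧          ≈⟨ -‿cong (*-homo-pos (suc m) j) ⟩
    - (suc m · 1# * ⟦ j ⟧)       ≈⟨ -‿distribˡ-* _ _ ⟩
    - (suc m · 1#) * ⟦ j ⟧       ∎

  ℤ-morphism : ℤ.+-*-rawRing -Raw-AlmostCommutative⟶ fromCommutativeRing R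
  ℤ-morphism = record
    { ⟦_⟧ = ⟦_⟧ ; +-homo = +-homo ; *-homo = *-homo ; -‿homo = neg-homo
    ; 0-homo = refl ; 1-homo = refl }

  -- Coefficients are compared as integers, because equality in the ring itself need not be
  -- decidable.
  _coeff≟_ : WeaklyDecidable (λ i j → ⟦ i ⟧ ≈ ⟦ j ⟧)
  i coeff≟ j with i ℤ.≟ j
  ... | yes i≡j = just (reflexive (≡.cong ⟦_⟧ i≡j))
  ... | no  _   = nothing

  open RingSolver ℤ.+-*-rawRing (fromCommutativeRing R) ℤ-morphism _coeff≟_ public
    using (solve; con; _:+_; _:*_; _:-_; :-_; _:=_)

-- Order properties of a constructive real field

module Order {c ℓ₁ ℓ₂} (ℝ : RealField c ℓ₁ ℓ₂) where
  open RealField ℝ public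
  open CommutativeRing commutativeRing public
    hiding (zero; Carrier; _≈_; _+_; _*_; -_; 0#; 1#; _-_; isCommutativeRing)
  open IntegerSolver commutativeRing public
    using (solve; con; _:+_; _:*_; _:-_; :-_; _:=_)
  open IsStrictPartialOrder isStrictPartialOrder public
    using (<-respˡ-≈; <-respʳ-≈) renaming (irrefl to <-irrefl; trans to <-trans)
  open IsHeytingField isHeytingField using (#-cotrans; invertible⇒#)

  <-cotrans : ∀ {x y} z → x < y → x < z ⊎ z < y
  <-cotrans z x<y with #-cotrans (inj₁ x<y) z
  ... | inj₁ (inj₁ x<z) = inj₁ x<z
  ... | inj₁ (inj₂ z<x) = inj₂ (<-trans z<x x<y)
  ... | inj₂ (inj₁ z<y) = inj₂ z<y
  ... | inj₂ (inj₂ y<z) = inj₁ (<-trans x<y y<z)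

  <⇒≤ : ∀ {x y} → x < y → x ≤ᴿ y
  <⇒≤ x<y y<x = <-irrefl refl (<-trans x<y y<x)

  ≤-reflexive : ∀ {x y} → x ≈ y → x ≤ᴿ y
  ≤-reflexive x≈y = <-irrefl (sym x≈y)

  ≤-refl : ∀ {x} → x ≤ᴿ x
  ≤-refl = ≤-reflexive refl

  ≤-trans : ∀ {x y z} → x ≤ᴿ y → y ≤ᴿ z → x ≤ᴿ z
  ≤-trans x≤y y≤z z<x = [ y≤z , x≤y ]′ (<-cotrans _ z<x)

  ≤-antisym : ∀ {x y} → x ≤ᴿ y → y ≤ᴿ x → x ≈ y
  ≤-antisym x≤y y≤x = proj₁ (tight _ _) [ y≤x , x≤y ]′

  ≤-respˡ : ∀ {x y z} → x ≈ y → x ≤ᴿ z → y ≤ᴿ z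
  ≤-respˡ x≈y = ≤-trans (≤-reflexive (sym x≈y))

  ≤-respʳ : ∀ {x y z} → x ≈ y → z ≤ᴿ x → z ≤ᴿ y
  ≤-respʳ x≈y z≤x = ≤-trans z≤x (≤-reflexive x≈y)

  ≈-stable : ∀ {x y} → ¬ ¬ (x ≈ y) → x ≈ y
  ≈-stable ¬¬x≈y = proj₁ (tight _ _) λ x#y → ¬¬x≈y λ x≈y → proj₂ (tight _ _) x≈y x#y

  ≤-total : ∀ x y → ¬ ¬ (x ≤ᴿ y ⊎ y ≤ᴿ x)
  ≤-total x y ¬x≤≥y = ¬x≤≥y (inj₁ λ y<x → ¬x≤≥y (inj₂ (<⇒≤ y<x)))

  ≤⇒¬¬≈⊎< : ∀ {x y} → x ≤ᴿ y → ¬ ¬ (x ≈ y ⊎ x < y)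
  ≤⇒¬¬≈⊎< x≤y k = k (inj₁ (proj₁ (tight _ _) [ k ∘ inj₂ , x≤y ]′))

  +-mono-≤ : ∀ {x y} z → x ≤ᴿ y → x + z ≤ᴿ y + z
  +-mono-≤ {x} {y} z x≤y y+z<x+z = x≤y
    (<-respˡ-≈ (cancel y) (<-respʳ-≈ (cancel x) (+-monoˡ-< (- z) y+z<x+z)))
    where
    cancel : ∀ w → w + z + - z ≈ w
    cancel w = solve 2 (λ w z → w :+ z :- z := w) refl w z

  ≤⇒0≤- : ∀ {x y} → x ≤ᴿ y → 0# ≤ᴿ y - x
  ≤⇒0≤- {x} x≤y = ≤-respˡ (-‿inverseʳ x) (+-mono-≤ (- x) x≤y)

  0≤-⇒≤ : ∀ {x y} → 0# ≤ᴿ y - x → x ≤ᴿ y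
  0≤-⇒≤ {x} {y} 0≤ = ≤-respˡ (+-identityˡ x)
    (≤-respʳ (solve 2 (λ x y → y :- x :+ x := y) refl x y) (+-mono-≤ x 0≤))

  0≤+ : ∀ {x y} → 0# ≤ᴿ x → 0# ≤ᴿ y → 0# ≤ᴿ x + y
  0≤+ {x} {y} 0≤x 0≤y = ≤-trans 0≤y (≤-respˡ (+-identityˡ y) (+-mono-≤ y 0≤x))

  -- The conclusion is a negation, so each factor may be assumed to be either zero or positive.
  0≤* : ∀ {x y} → 0# ≤ᴿ x → 0# ≤ᴿ y → 0# ≤ᴿ x * y
  0≤* {x} {y} 0≤x 0≤y xy<0 = ≤⇒¬¬≈⊎< 0≤x λ where
    (inj₁ 0≈x) → ≤-reflexive (sym (trans (*-congʳ (sym 0≈x)) (zeroˡ y))) xy<0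
    (inj₂ 0<x) → ≤⇒¬¬≈⊎< 0≤y λ where
      (inj₁ 0≈y) → ≤-reflexive (sym (trans (*-congˡ (sym 0≈y)) (zeroʳ x))) xy<0
      (inj₂ 0<y) → <⇒≤ (*-pos 0<x 0<y) xy<0

  *-mono-≤ : ∀ {x y u v} → 0# ≤ᴿ x → 0# ≤ᴿ v → x ≤ᴿ y → u ≤ᴿ v → x * u ≤ᴿ y * v
  *-mono-≤ {x} {y} {u} {v} 0≤x 0≤v x≤y u≤v = 0≤-⇒≤ (≤-respʳ
    (solve 4 (λ x y u v → (y :- x) :* v :+ x :* (v :- u) := y :* v :- x :* u) refl x y u v)
    (0≤+ (0≤* (≤⇒0≤- x≤y) 0≤v) (0≤* 0≤x (≤⇒0≤- u≤v))))

  neg-positive : ∀ {x} → x < 0# → 0# < - x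
  neg-positive {x} x<0 = <-respˡ-≈ (-‿inverseʳ x) (<-respʳ-≈ (+-identityˡ (- x)) (+-monoˡ-< (- x) x<0))

  0<1 : 0# < 1#
  0<1 with invertible⇒# {1#} {0#} (1# , left , right)
    where
    left : 1# * (1# - 0#) ≈ 1#
    left = solve 0 (con (+ 1) :* (con (+ 1) :- con (+ 0)) := con (+ 1)) refl
    right : (1# - 0#) * 1# ≈ 1#
    right = solve 0 ((con (+ 1) :- con (+ 0)) :* con (+ 1) := con (+ 1)) refl
  ... | inj₂ 0<1 = 0<1
  ... | inj₁ 1<0 = ⊥-elim (<⇒≤ 1<0 (<-respʳ-≈ -1*-1≈1 (*-pos (neg-positive 1<0) (neg-positive 1<0))))
    where
    -1*-1≈1 : - 1# * - 1# ≈ 1#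
    -1*-1≈1 = solve 0 ((:- con (+ 1)) :* (:- con (+ 1)) := con (+ 1)) refl

  -1<0 : - 1# < 0#
  -1<0 = <-respˡ-≈ (+-identityˡ (- 1#)) (<-respʳ-≈ (-‿inverseʳ 1#) (+-monoˡ-< (- 1#) 0<1))

  0≤1 : 0# ≤ᴿ 1#
  0≤1 = <⇒≤ 0<1

  *-pos-cancel : ∀ {x y} → 0# < y → 0# ≤ᴿ x * y → 0# ≤ᴿ x
  *-pos-cancel {x} {y} 0<y 0≤xy x<0 = 0≤xy (<-respˡ-≈ (+-identityˡ (x * y))
    (<-respʳ-≈ (solve 2 (λ x y → (:- x) :* y :+ x :* y := con (+ 0)) refl x y)
      (+-monoˡ-< (x * y) (*-pos (neg-positive x<0) 0<y))))

  x²≈0⇒x≈0 : ∀ {x} → x * x ≈ 0# → x ≈ 0#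
  x²≈0⇒x≈0 {x} x²≈0 = proj₁ (tight _ _) λ where
    (inj₁ x<0) → <-irrefl (sym (trans (solve 1 (λ x → (:- x) :* (:- x) := x :* x) refl x) x²≈0))
      (*-pos (neg-positive x<0) (neg-positive x<0))
    (inj₂ 0<x) → <-irrefl (sym x²≈0) (*-pos 0<x 0<x)

-- Reading the list, the credit rises at the positions of sign c, falls at the
-- others and never becomes negative; the indices are its initial and final values.
data Ballot {I : Set} (s : I → Bool) (c : Bool) : ℕ → List I → ℕ → Set where
  []   : ∀ {b} → Ballot s c b [] b
  up   : ∀ {b e i l} → s i ≡ c → Ballot s c (suc b) l e → Ballot s c b (i ∷ l) e
  down : ∀ {b e i l} → s i ≡ not c → Ballot s c b l e → Ballot s c (suc b) (i ∷ l) e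

-- Inequalities on the interval from -1 to 1, with their cases of equality

module Inequalities {c ℓ₁ ℓ₂} (ℝ : RealField c ℓ₁ ℓ₂) where
  open Order ℝ public

  private variable
    q : Level
    P Q : Set q
    x y : Carrier

  2# : Carrier
  2# = 1# + 1#

  Unit Neg : Carrier → Set ℓ₂
  Unit x = 0# ≤ᴿ x × 0# ≤ᴿ 1# - x
  Neg x  = 0# ≤ᴿ - x × 0# ≤ᴿ 1# + x

  -- Encodes x ∈ {0, -1} by an equation, which unlike a disjunction is stable
  -- under double negation.
  Root : Carrier → Set ℓ₁
  Root x = x * (1# + x) ≈ 0#

  Neg-0 : Neg 0#
  Neg-0 = ≤-reflexive (solve 0 (con (+ 0) := :- con (+ 0)) refl) , ≤-respʳ (sym (+-identityʳ 1#)) 0≤1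

  Unit-1 : Unit 1#
  Unit-1 = 0≤1 , ≤-reflexive (sym (-‿inverseʳ 1#))

  Neg-resp : x ≈ y → Neg x → Neg y
  Neg-resp x≈y (a , b) = ≤-respʳ (-‿cong x≈y) a , ≤-respʳ (+-congˡ x≈y) b

  Root-resp : x ≈ y → Root x → Root y
  Root-resp x≈y = trans (*-cong (sym x≈y) (+-congˡ (sym x≈y)))

  ≈0⇒Root : x ≈ 0# → Root x
  ≈0⇒Root {x} x≈0 = trans (*-congʳ x≈0) (zeroˡ (1# + x))

  Unit*Unit : Unit x → Unit y → Unit (x * y)
  Unit*Unit {x} {y} (0≤x , x≤1) (0≤y , y≤1) = 0≤* 0≤x 0≤y ,
    ≤-respʳ (solve 2 (λ x y → (con (+ 1) :- x) :+ x :* (con (+ 1) :- y) := con (+ 1) :- x :* y) refl x y)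
      (0≤+ x≤1 (0≤* 0≤x y≤1))

  Unit*Neg : Unit x → Neg y → Neg (x * y)
  Unit*Neg {x} {y} (0≤x , x≤1) (y≤0 , -1≤y) =
    ≤-respʳ (solve 2 (λ x y → x :* (:- y) := :- (x :* y)) refl x y) (0≤* 0≤x y≤0) ,
    ≤-respʳ (solve 2 (λ x y → (con (+ 1) :- x) :+ x :* (con (+ 1) :+ y) := con (+ 1) :+ x :* y) refl x y)
      (0≤+ x≤1 (0≤* 0≤x -1≤y))

  Neg*Unit : Neg x → Unit y → Neg (x * y)
  Neg*Unit n u = Neg-resp (*-comm _ _) (Unit*Neg u n)

  Neg*Neg : Neg x → Neg y → Unit (x * y)
  Neg*Neg {x} {y} (x≤0 , -1≤x) (y≤0 , -1≤y) =
    ≤-respʳ (solve 2 (λ x y → (:- x) :* (:- y) := x :* y) refl x y) (0≤* x≤0 y≤0) ,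
    ≤-respʳ (solve 2 (λ x y → (con (+ 1) :+ x) :+ (:- x) :* (con (+ 1) :+ y) := con (+ 1) :- x :* y) refl x y)
      (0≤+ -1≤x (0≤* x≤0 -1≤y))

  Neg⇒0≤1- : Neg x → 0# ≤ᴿ 1# - x
  Neg⇒0≤1- (x≤0 , _) = 0≤+ 0≤1 x≤0

  0≤x² : Unit x → 0# ≤ᴿ x * x
  0≤x² (0≤x , _) = 0≤* 0≤x 0≤x

  0≤1-x² : Unit x → 0# ≤ᴿ 1# - x * x
  0≤1-x² u = proj₂ (Unit*Unit u u)

  -≤ : 0# ≤ᴿ y → x - y ≤ᴿ x
  -≤ {y} {x} 0≤y = 0≤-⇒≤ (≤-respʳ (solve 2 (λ x y → y := x :- (x :- y)) refl x y) 0≤y)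

  0<2 : 0# < 2#
  0<2 = <-trans 0<1 (<-respˡ-≈ (+-identityˡ 1#) (+-monoˡ-< 1# 0<1))

  2^-pos : ∀ n → 0# < 2# ^ n
  2^-pos zero    = 0<1
  2^-pos (suc n) = *-pos 0<2 (2^-pos n)

  2^-suc : ∀ n → 2# ^ n < 2# ^ suc n
  2^-suc n = <-respʳ-≈ (solve 1 (λ x → x :+ x := con (+ 2) :* x) refl (2# ^ n))
    (<-respˡ-≈ (+-identityˡ _) (+-monoˡ-< (2# ^ n) (2^-pos n)))

  2^-mono-<′ : ∀ {m n} → m ℕ.<′ n → 2# ^ m < 2# ^ n
  2^-mono-<′ {m}         ℕ.≤′-refl       = 2^-suc m
  2^-mono-<′ {n = suc n} (ℕ.≤′-step m<n) = <-trans (2^-mono-<′ m<n) (2^-suc n)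

  2^-mono : ∀ {m n} → m ℕ.≤ n → 2# ^ m ≤ᴿ 2# ^ n
  2^-mono m≤n with ℕ.≤⇒≤′ m≤n
  ... | ℕ.≤′-refl       = ≤-refl
  ... | ℕ.≤′-step m≤′n = <⇒≤ (2^-mono-<′ (ℕ.s≤′s m≤′n))

  2^-cancel-≤ : ∀ {m n} → 2# ^ m ≤ᴿ 2# ^ n → m ℕ.≤ n
  2^-cancel-≤ 2^m≤2^n = ℕ.≮⇒≥ λ n<m → 2^m≤2^n (2^-mono-<′ (ℕ.≤⇒≤′ n<m))

  *≈0-cancelʳ : 0# < y → x * y ≈ 0# → x ≈ 0#
  *≈0-cancelʳ {y} {x} 0<y xy≈0 = ≤-antisym
    (0≤-⇒≤ (*-pos-cancel 0<y (≤-reflexive (sym (trans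
      (solve 2 (λ x y → (con (+ 0) :- x) :* y := :- (x :* y)) refl x y)
      (trans (-‿cong xy≈0) (solve 0 (:- con (+ 0) := con (+ 0)) refl)))))))
    (*-pos-cancel 0<y (≤-reflexive (sym xy≈0)))

  +≈0ˡ : 0# ≤ᴿ x → 0# ≤ᴿ y → x + y ≈ 0# → x ≈ 0#
  +≈0ˡ {x} {y} 0≤x 0≤y x+y≈0 = ≤-antisym (≤-respʳ x+y≈0 (0≤-⇒≤ (≤-respʳ
    (solve 2 (λ x y → y := x :+ y :- x) refl x y) 0≤y))) 0≤x

  +≈0ʳ : 0# ≤ᴿ x → 0# ≤ᴿ y → x + y ≈ 0# → y ≈ 0#
  +≈0ʳ 0≤x 0≤y x+y≈0 = +≈0ˡ 0≤y 0≤x (trans (+-comm _ _) x+y≈0)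

  ≈⇒-≈0 : x ≈ y → y - x ≈ 0#
  ≈⇒-≈0 x≈y = trans (+-congˡ (-‿cong x≈y)) (-‿inverseʳ _)

  -≈0⇒≈ : x - y ≈ 0# → y ≈ x
  -≈0⇒≈ {x} {y} x-y≈0 = trans (sym (+-identityˡ y)) (trans (+-congʳ (sym x-y≈0))
    (solve 2 (λ x y → x :- y :+ y := x) refl x y))

  1-x²≈1⇒x≈0 : 1# - x * x ≈ 1# → x ≈ 0#
  1-x²≈1⇒x≈0 {x} eq = x²≈0⇒x≈0 (trans
    (solve 1 (λ x → x :* x := con (+ 1) :- (con (+ 1) :- x :* x)) refl x) (≈⇒-≈0 eq))

  -- An inequality bundled with what its equality case implies, so that the bound and the
  -- description of the maximisers come out of one induction.
  Tight : ∀ {q} → Carrier → Carrier → Set q → Set (ℓ₁ ⊔ ℓ₂ ⊔ q)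
  Tight x y Q = x ≤ᴿ y × (x ≈ y → Q)

  Tight-map : (P → Q) → Tight x y P → Tight x y Q
  Tight-map f (x≤y , eq) = x≤y , λ x≈y → f (eq x≈y)

  Tight-transˡ : ∀ {z} → x ≤ᴿ y → Tight y z Q → Tight x z Q
  Tight-transˡ x≤y (y≤z , eq) = ≤-trans x≤y y≤z , λ x≈z → eq (≤-antisym y≤z (≤-respˡ x≈z x≤y))

  Tight-transʳ : ∀ {z} → Tight x y Q → y ≤ᴿ z → Tight x z Q
  Tight-transʳ (x≤y , eq) y≤z = ≤-trans x≤y y≤z , λ x≈z → eq (≤-antisym x≤y (≤-respʳ (sym x≈z) y≤z))

  -- The gap `y * v - x * u` is the sum of the nonnegative terms `(y - x) * v` and `x * (v - u)`. If
  -- it vanishes, the first gives `x ≈ y`; only then is `x` known to be positive, and the second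
  -- gives `u ≈ v`.
  Tight-* : ∀ {u v} → 0# ≤ᴿ x → 0# < y → 0# < v → Tight x y P → Tight u v Q → Tight (x * u) (y * v) (P × Q)
  Tight-* {x} {y} {u = u} {v} 0≤x 0<y 0<v (x≤y , p) (u≤v , q) =
    *-mono-≤ 0≤x (<⇒≤ 0<v) x≤y u≤v , λ xu≈yv →
      let sum≈0 : (y - x) * v + x * (v - u) ≈ 0#
          sum≈0 = trans
            (solve 4 (λ x y u v → (y :- x) :* v :+ x :* (v :- u) := y :* v :- x :* u) refl x y u v)
            (≈⇒-≈0 xu≈yv)
          0≤yv-xv = 0≤* (≤⇒0≤- x≤y) (<⇒≤ 0<v)
          0≤xv-xu = 0≤* 0≤x (≤⇒0≤- u≤v)
          x≈y = -≈0⇒≈ (*≈0-cancelʳ 0<v (+≈0ˡ 0≤yv-xv 0≤xv-xu sum≈0))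
          0<x = <-respʳ-≈ (sym x≈y) 0<y
          u≈v = -≈0⇒≈ (*≈0-cancelʳ 0<x (trans (*-comm _ _) (+≈0ʳ 0≤yv-xv 0≤xv-xu sum≈0)))
      in p x≈y , q u≈v

  -- The factor contributed by a third position when two adjacent positions
  -- with ratio ρ are removed; τ is its ratio to the nearer of the two.
  g : Carrier → Carrier → Carrier
  g ρ τ = (1# - τ) * (1# - ρ * τ)

  g-cong : ∀ {ρ} → x ≈ y → g ρ x ≈ g ρ y
  g-cong x≈y = *-cong (+-congˡ (-‿cong x≈y)) (+-congˡ (-‿cong (*-congˡ x≈y)))

  module _ {ρ} (ρ-neg : Neg ρ) where

    0≤g-Unit : Unit x → 0# ≤ᴿ g ρ x
    0≤g-Unit u = 0≤* (proj₂ u) (Neg⇒0≤1- (Neg*Unit ρ-neg u))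

    0≤g-Neg : Neg x → 0# ≤ᴿ g ρ x
    0≤g-Neg n = 0≤* (Neg⇒0≤1- n) (proj₂ (Neg*Neg ρ-neg n))

    g≤1-x² : Unit x → g ρ x ≤ᴿ 1# - x * x
    g≤1-x² {x} (0≤x , x≤1) = 0≤-⇒≤ (≤-respʳ
      (solve 2 (λ ρ x → (con (+ 1) :- x) :* (x :* (con (+ 1) :+ ρ))
          := con (+ 1) :- x :* x :- (con (+ 1) :- x) :* (con (+ 1) :- ρ :* x)) refl ρ x)
      (0≤* x≤1 (0≤* 0≤x (proj₂ ρ-neg))))

    -- With p = -ρx and q = -xβ the claim is (1+p)(1+q)(1-ρxβ) ≤ 1+x, and
    -- (1+p)(1+q) = (1+x)(1+ρxβ) - x(1+ρ)(1+β).
    g*g≤1-x² : ∀ {β} → Unit x → Neg β → g ρ x * g ρ (x * β) ≤ᴿ 1# - x * x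
    g*g≤1-x² {x} {β} u@(0≤x , x≤1) n@(β≤0 , -1≤β) = 0≤-⇒≤ (≤-respʳ
      (solve 3 (λ ρ x β →
          (con (+ 1) :- x) :*
            (x :* ((con (+ 1) :+ ρ) :* (con (+ 1) :+ β)) :* (con (+ 1) :- ρ :* (x :* β))
              :+ (con (+ 1) :+ x) :* ((ρ :* (x :* β)) :* (ρ :* (x :* β))))
          := con (+ 1) :- x :* x :-
            (con (+ 1) :- x) :* (con (+ 1) :- ρ :* x) :*
              ((con (+ 1) :- x :* β) :* (con (+ 1) :- ρ :* (x :* β)))) refl ρ x β)
      (0≤* x≤1 (0≤+ (0≤* (0≤* 0≤x (0≤* (proj₂ ρ-neg) -1≤β)) (proj₂ m))
                    (0≤* (0≤+ 0≤1 0≤x) (0≤x² m)))))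
      where m = Neg*Neg ρ-neg (Unit*Neg u n)

    -- With `p = ρ * x`, the products `(1 - ρ)(1 - x)` and `(1 + ρ)(1 + x)` add up to `2(1 + p)`;
    -- multiplying by `1 - p` gives the gap `2p² + (1 + ρ)(1 + x)(1 - p)`. Equality forces `p = 0`
    -- and then `1 + ρ + x = 0`, so one of `ρ`, `x` is 0 and the other is -1.
    [1-ρ]*g≤2 : Neg x → Tight ((1# - ρ) * g ρ x) 2# (Root ρ × Root x)
    [1-ρ]*g≤2 {x} n = 0≤-⇒≤ (≤-respʳ identity (0≤+ 0≤a 0≤b)) , λ eq →
      let a+b≈0 = trans identity (≈⇒-≈0 eq)
          ρx≈0  = x²≈0⇒x≈0 (*≈0-cancelʳ 0<2 (trans (*-comm _ _) (+≈0ˡ 0≤a 0≤b a+b≈0)))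
          b≈0   = +≈0ʳ 0≤a 0≤b a+b≈0
          sum≈0 : 1# + ρ + x ≈ 0#
          sum≈0 = trans
            (solve 2 (λ ρ x → con (+ 1) :+ ρ :+ x :=
                (con (+ 1) :+ ρ) :* (con (+ 1) :+ x) :* (con (+ 1) :- ρ :* x)
                  :+ ρ :* x :* (ρ :+ x :+ ρ :* x)) refl ρ x)
            (trans (+-cong b≈0 (trans (*-congʳ ρx≈0) (zeroˡ _))) (+-identityˡ 0#))
      in trans (solve 2 (λ ρ x → ρ :* (con (+ 1) :+ ρ) := ρ :* (con (+ 1) :+ ρ :+ x) :- ρ :* x) refl ρ x)
           (zero- sum≈0 ρx≈0)
       , trans (solve 2 (λ ρ x → x :* (con (+ 1) :+ x) := x :* (con (+ 1) :+ ρ :+ x) :- ρ :* x) refl ρ x)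
           (zero- sum≈0 ρx≈0)
      where
      a = 2# * ((ρ * x) * (ρ * x))
      b = (1# + ρ) * (1# + x) * (1# - ρ * x)
      0≤a : 0# ≤ᴿ a
      0≤a = 0≤* (<⇒≤ 0<2) (0≤x² (Neg*Neg ρ-neg n))
      0≤b : 0# ≤ᴿ b
      0≤b = 0≤* (0≤* (proj₂ ρ-neg) (proj₂ n)) (proj₂ (Neg*Neg ρ-neg n))
      identity : a + b ≈ 2# - (1# - ρ) * g ρ x
      identity = solve 2 (λ ρ x →
        con (+ 2) :* ((ρ :* x) :* (ρ :* x)) :+ (con (+ 1) :+ ρ) :* (con (+ 1) :+ x) :* (con (+ 1) :- ρ :* x)
        := con (+ 2) :- (con (+ 1) :- ρ) :* ((con (+ 1) :- x) :* (con (+ 1) :- ρ :* x))) refl ρ x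
      zero- : ∀ {y z w} → y ≈ 0# → z ≈ 0# → w * y - z ≈ 0#
      zero- {y} {z} {w} y≈0 z≈0 = trans (+-cong (*-congˡ y≈0) (-‿cong z≈0))
        (solve 1 (λ w → w :* con (+ 0) :- con (+ 0) := con (+ 0)) refl w)

  module _ {I : Set} where

    prod : (I → Carrier) → List I → Carrier
    prod f []      = 1#
    prod f (i ∷ l) = f i * prod f l

    prod-cong : ∀ {f h : I → Carrier} {l} → All (λ i → f i ≈ h i) l → prod f l ≈ prod h l
    prod-cong []         = refl
    prod-cong (eq ∷ eqs) = *-cong eq (prod-cong eqs)

    prod-* : ∀ (f h : I → Carrier) l → prod f l * prod h l ≈ prod (λ i → f i * h i) l
    prod-* f h []      = *-identityˡ 1#
    prod-* f h (i ∷ l) = trans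
      (solve 4 (λ a b c d → (a :* b) :* (c :* d) := (a :* c) :* (b :* d)) refl
        (f i) (prod f l) (h i) (prod h l))
      (*-congˡ (prod-* f h l))

  -- A position i of sign col nearer to the removed pair than a position j of
  -- the opposite sign has g ρ (T i) * g ρ (T j) ≤ 1; going outwards, each j is
  -- matched with such an i, kept on a stack.  The k units of initial credit
  -- leave at most k positions j unmatched.  Bounding by H instead of 1 makes
  -- equality force T i ≈ 0 for the i on the stack.
  module Sweep {I : Set} (s : I → Bool) (col : Bool) (T : I → Carrier) {ρ} (ρ-neg : Neg ρ) where

    InRange : I → Set ℓ₂
    InRange i = (s i ≡ col → Unit (T i)) × (s i ≡ not col → Neg (T i))

    -- Here `β` is the ratio between the two positions themselves; this is the form in which
    -- `g*g≤1-x²` can match them.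
    Precedes : I → I → Set (c ⊔ ℓ₁ ⊔ ℓ₂)
    Precedes i j = s i ≡ col → s j ≡ not col → ∃[ β ] (Neg β × T j ≈ T i * β)

    G H : I → Carrier
    G i = g ρ (T i)
    H i = 1# - T i * T i

    -- Only the position nearest to the removed ones becomes their neighbour; the ratios farther out
    -- are covered by the induction hypothesis.
    HeadRoot : List I → Set ℓ₁
    HeadRoot []      = ⊤
    HeadRoot (i ∷ _) = Root (T i)

    prodV : ∀ {k} → Vec Carrier k → Carrier
    prodV []       = 1#
    prodV (u ∷ us) = g ρ u * prodV us

    0≤prodV : ∀ {k} {us : Vec Carrier k} → VecAll.All Neg us → 0# ≤ᴿ prodV us
    0≤prodV []       = 0≤1
    0≤prodV (n ∷ ns) = 0≤* (0≤g-Neg ρ-neg n) (0≤prodV ns)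

    0≤H : ∀ {l} → All (λ i → Unit (T i)) l → 0# ≤ᴿ prod H l
    0≤H []       = 0≤1
    0≤H (u ∷ us) = 0≤* (0≤1-x² u) (0≤H us)

    0≤G : ∀ {l} → All (λ i → Unit (T i)) l → 0# ≤ᴿ prod G l
    0≤G []       = 0≤1
    0≤G (u ∷ us) = 0≤* (0≤g-Unit ρ-neg u) (0≤G us)

    G≤H : ∀ {l} → All (λ i → Unit (T i)) l → prod G l ≤ᴿ prod H l
    G≤H []       = ≤-refl
    G≤H (u ∷ us) = *-mono-≤ (0≤g-Unit ρ-neg u) (0≤H us) (g≤1-x² ρ-neg u) (G≤H us)

    0≤prodG : ∀ {b l e} → Ballot s col b l e → All InRange l → 0# ≤ᴿ prod G l
    0≤prodG []          []                 = 0≤1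
    0≤prodG (up p bs)   ((unit , _) ∷ rs) = 0≤* (0≤g-Unit ρ-neg (unit p)) (0≤prodG bs rs)
    0≤prodG (down p bs) ((_ , neg) ∷ rs)  = 0≤* (0≤g-Neg ρ-neg (neg p)) (0≤prodG bs rs)

    1≈gρ0*1 : 1# ≈ g ρ 0# * 1#
    1≈gρ0*1 = solve 1 (λ ρ → con (+ 1) :=
      (con (+ 1) :- con (+ 0)) :* (con (+ 1) :- ρ :* con (+ 0)) :* con (+ 1)) refl ρ

    -- Since `g ρ 0#` is 1, initial credit that is never spent can be recorded as zeros.
    zeros : ∀ k → ∃[ us ] (VecAll.All Neg {n = k} us × 1# ≈ prodV us)
    zeros zero    = [] , [] , refl
    zeros (suc k) = let us , ns , eq = zeros k in
      0# ∷ us , Neg-0 ∷ ns , trans 1≈gρ0*1 (*-congˡ eq)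

    -- Invariant: `st` holds the positions of sign `col` still unmatched, and the current credit is
    -- its length plus the `k` units of initial credit not yet spent. The ratios that spend them are
    -- collected in `us`.
    sweep : ∀ k st {b l e} → Ballot s col b l e → b ≡ length st ℕ.+ k →
      All (λ i → s i ≡ col × Unit (T i)) st → All (λ i → All (Precedes i) l) st →
      All InRange l → AllPairs Precedes l →
      ∃[ us ] (VecAll.All Neg {n = k} us × prod G l * prod G st ≤ᴿ prod H st * prodV us)
    sweep k st [] _ goods _ _ _ = let us , ns , eq = zeros k in
      us , ns , ≤-respˡ (*-comm _ _) (≤-respʳ (*-congˡ eq)
        (*-mono-≤ (0≤G units) 0≤1 (G≤H units) ≤-refl))
      where
      units = All.map proj₂ goods
    -- `i` is pushed on the stack; the recursive bound then contains `H i`, which is at most 1 and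
    -- is dropped.
    sweep k st (up {i = i} {l} p bs) eq goods precs (r ∷ rs) (q ∷ qs) =
      let us , ns , le = sweep k (i ∷ st) bs (≡.cong suc eq) ((p , u) ∷ goods)
                           (q ∷ All.map All.tail precs) rs qs in
      us , ns , ≤-trans
        (≤-respˡ (solve 3 (λ a b c → b :* (a :* c) := (a :* b) :* c) refl (G i) (prod G l) (prod G st)) le)
        (≤-respʳ (*-identityˡ _) (≤-respˡ (sym (*-assoc _ _ _))
          (*-mono-≤ (0≤1-x² u) (0≤* (0≤H (All.map proj₂ goods)) (0≤prodV ns)) (-≤ (0≤x² u)) ≤-refl)))
      where
      u = proj₁ r p
    -- With an empty stack `i` cannot be matched, so it spends a unit of initial credit and its
    -- ratio joins `us`.
    sweep (suc k) [] (down {i = i} {l} p bs) ≡.refl goods precs (r ∷ rs) (q ∷ qs) =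
      let us , ns , le = sweep k [] bs ≡.refl [] [] rs qs in
      T i ∷ us , proj₂ r p ∷ ns ,
        ≤-respˡ (sym (*-assoc _ _ _)) (≤-respʳ
          (solve 2 (λ a b → a :* (con (+ 1) :* b) := con (+ 1) :* (a :* b)) refl (G i) (prodV us))
          (*-mono-≤ (0≤g-Neg ρ-neg (proj₂ r p)) (0≤* 0≤1 (0≤prodV ns)) ≤-refl le))
    -- `a` is popped and matched with `i`: `G a * G i` is at most `H a`, which is exactly what the
    -- conclusion allots to `a`.
    sweep k (a ∷ st) (down {i = i} {l} p bs) ≡.refl ((sa , u) ∷ goods) ((pa ∷ _) ∷ precs) (r ∷ rs) (q ∷ qs) =
      let us , ns , le = sweep k st bs ≡.refl goods (All.map All.tail precs) rs qs
          β , β-neg , eq = pa sa p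
      in us , ns ,
        ≤-respˡ (solve 4 (λ a b c d → (a :* b) :* (c :* d) := (b :* c) :* (a :* d)) refl
          (G a) (G i) (prod G l) (prod G st))
        (≤-respʳ (sym (*-assoc _ _ _))
        (*-mono-≤ (0≤* (0≤g-Unit ρ-neg u) (0≤g-Neg ρ-neg (proj₂ r p)))
          (0≤* (0≤H (All.map proj₂ goods)) (0≤prodV ns))
          (≤-respˡ (*-congˡ (g-cong (sym eq))) (g*g≤1-x² ρ-neg u β-neg)) le))

    -- Credit 0 forces the head to have sign `col`. It is put on the stack by hand, since the `up`
    -- case of `sweep` would discard its `H`; the surviving bound `1# - T i * T i` makes equality
    -- force `T i ≈ 0#`.
    sweep₀ : ∀ {l e} → Ballot s col 0 l e → All InRange l → AllPairs Precedes l →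
      Tight (prod G l) 1# (HeadRoot l)
    sweep₀ [] [] [] = ≤-refl , λ _ → tt
    sweep₀ (up {i = i} {l} p bs) (r ∷ rs) (q ∷ qs)
      with sweep 0 (i ∷ []) bs ≡.refl ((p , proj₁ r p) ∷ []) (q ∷ []) rs qs
    ... | [] , [] , le = Tight-transˡ
      (≤-respˡ (solve 2 (λ a b → a :* (b :* con (+ 1)) := b :* a) refl (prod G l) (G i))
        (≤-respʳ (solve 1 (λ h → h :* con (+ 1) :* con (+ 1) := h) refl (H i)) le))
      (-≤ (0≤x² (proj₁ r p)) , λ eq → ≈0⇒Root (1-x²≈1⇒x≈0 eq))

    -- `u` is the ratio of the one position that may stay unmatched. If the head goes up, `d` is its
    -- `H` and equality makes its ratio zero. If it goes down, it is itself the unmatched position,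
    -- which is why the conclusion on the head may rely on `Root u`.
    sweep₁ : ∀ {l e} → Ballot s col 1 l e → All InRange l → AllPairs Precedes l →
      ∃[ u ] ∃[ d ] (Neg u × 0# ≤ᴿ d × prod G l ≤ᴿ g ρ u * d × Tight d 1# (Root u → HeadRoot l))
    sweep₁ [] [] [] = 0# , 1# , Neg-0 , 0≤1 ,
      ≤-reflexive 1≈gρ0*1 ,
      ≤-refl , λ _ _ → tt
    sweep₁ (up {i = i} {l} p bs) (r ∷ rs) (q ∷ qs)
      with sweep 1 (i ∷ []) bs ≡.refl ((p , proj₁ r p) ∷ []) (q ∷ []) rs qs
    ... | u ∷ [] , n ∷ [] , le = u , H i , n , 0≤1-x² (proj₁ r p) ,
      ≤-respˡ (solve 2 (λ a b → a :* (b :* con (+ 1)) := b :* a) refl (prod G l) (G i))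
        (≤-respʳ (solve 2 (λ h g → h :* con (+ 1) :* (g :* con (+ 1)) := g :* h) refl (H i) (g ρ u)) le) ,
      -≤ (0≤x² (proj₁ r p)) , λ eq _ → ≈0⇒Root (1-x²≈1⇒x≈0 eq)
    sweep₁ (down {i = i} p bs) (r ∷ rs) (q ∷ qs) =
      T i , 1# , proj₂ r p , 0≤1 ,
      *-mono-≤ (0≤g-Neg ρ-neg (proj₂ r p)) 0≤1 ≤-refl (proj₁ (sweep₀ bs rs qs)) ,
      ≤-refl , λ _ root → root

-- Lists cut in two, and sign walks

module _ {I : Set} where

  -- In `L ʳ++ m` the list `L` is read away from the cut. Both neighbours of the cut are thus heads
  -- of lists, and the order along `L` is flipped.
  ʳ++-AllPairs⁻ : ∀ {ℓ} {_≺_ : Rel I ℓ} L {m} → AllPairs _≺_ (L ʳ++ m) →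
    AllPairs (flip _≺_) L × All (λ a → All (a ≺_) m) L × AllPairs _≺_ m
  ʳ++-AllPairs⁻ []      ps = [] , [] , ps
  ʳ++-AllPairs⁻ (a ∷ L) ps with ʳ++-AllPairs⁻ L ps
  ... | qs , cross , (am ∷ ms) = All.map All.head cross ∷ qs , am ∷ All.map All.tail cross , ms

  ʳ++-AllPairs⁺ : ∀ {ℓ} {_≺_ : Rel I ℓ} L {m} → AllPairs (flip _≺_) L →
    All (λ a → All (a ≺_) m) L → AllPairs _≺_ m → AllPairs _≺_ (L ʳ++ m)
  ʳ++-AllPairs⁺ []      _        _            ms = ms
  ʳ++-AllPairs⁺ (a ∷ L) (q ∷ qs) (am ∷ cross) ms =
    ʳ++-AllPairs⁺ L qs (All.zipWith (λ (b≺a , b≺m) → b≺a ∷ b≺m) (q , cross)) (am ∷ ms)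

  ʳ++-Linked⁻ : ∀ {ℓ} {Q : Rel I ℓ} L {m} → Linked Q (L ʳ++ m) → Linked Q m
  ʳ++-Linked⁻ []      qs = qs
  ʳ++-Linked⁻ (_ ∷ L) qs = Linked.tail (ʳ++-Linked⁻ L qs)

  ʳ++-Linked-replace : ∀ {ℓ} {Q : Rel I ℓ} L {a m m′} →
    Linked Q (L ʳ++ (a ∷ m)) → Linked Q (a ∷ m′) → Linked Q (L ʳ++ (a ∷ m′))
  ʳ++-Linked-replace []      _  new = new
  ʳ++-Linked-replace (_ ∷ L) qs new = ʳ++-Linked-replace L qs (Linked.head (ʳ++-Linked⁻ L qs) ∷ new)

  length-ʳ++-∷∷ : ∀ L {x y : I} {m} → length (L ʳ++ (x ∷ y ∷ m)) ≡ suc (suc (length (L ʳ++ m)))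
  length-ʳ++-∷∷ L = ≡.trans (length-ʳ++ L) (≡.trans (ℕ.+-suc _ _) (≡.cong suc
    (≡.trans (ℕ.+-suc _ _) (≡.cong suc (≡.sym (length-ʳ++ L))))))

  module _ {s : I → Bool} where

    Ballot-++ : ∀ {c b e d l m} → Ballot s c b l e → Ballot s c e m d → Ballot s c b (l ++ m) d
    Ballot-++ []          cs = cs
    Ballot-++ (up p bs)   cs = up p (Ballot-++ bs cs)
    Ballot-++ (down p bs) cs = down p (Ballot-++ bs cs)

    Ballot-suc : ∀ {c b e l} → Ballot s c b l e → Ballot s c (suc b) l (suc e)
    Ballot-suc []          = []
    Ballot-suc (up p bs)   = up p (Ballot-suc bs)
    Ballot-suc (down p bs) = down p (Ballot-suc bs)

    -- Read backwards, a step up becomes a step down, so `c` turns into `not c` and the initial and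
    -- final credits change places.
    Ballot-ʳ++ : ∀ {c b e d l m} → Ballot s c b l e → Ballot s (not c) b m d → Ballot s (not c) e (l ʳ++ m) d
    Ballot-ʳ++ []                  cs = cs
    Ballot-ʳ++ {c} (up p bs)       cs = Ballot-ʳ++ bs (down (≡.trans p (≡.sym (not-involutive c))) cs)
    Ballot-ʳ++ (down p bs)         cs = Ballot-ʳ++ bs (up p cs)

    -- The walk after a last minimum never returns to that height. The credit of the rest is counted
    -- from one step above it and so starts at 0.
    data StrictBallot (c : Bool) : List I → Set where
      []  : StrictBallot c []
      _∷_ : ∀ {x l d} → s x ≡ c → Ballot s c 0 l d → StrictBallot c (x ∷ l)

    StrictBallot⇒Ballot : ∀ {c l} → StrictBallot c l → ∃[ d ] Ballot s c 0 l d
    StrictBallot⇒Ballot []       = _ , []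
    StrictBallot⇒Ballot (p ∷ bs) = _ , up p (Ballot-suc bs)

  ≡⊎≡not : ∀ b c → b ≡ c ⊎ b ≡ not c
  ≡⊎≡not false false = inj₁ ≡.refl
  ≡⊎≡not false true  = inj₂ ≡.refl
  ≡⊎≡not true  false = inj₂ ≡.refl
  ≡⊎≡not true  true  = inj₁ ≡.refl

  -- Read l as a walk stepping up at the positions of sign c and down at the
  -- others; it is cut where it attains its minimum for the last time.
  splitAtMin : ∀ (s : I → Bool) c l →
    ∃[ L ] ∃[ R ] ∃[ e ] (l ≡ L ++ R × Ballot s c e L 0 × StrictBallot {s} c R)
  splitAtMin s c [] = [] , [] , 0 , ≡.refl , [] , []
  splitAtMin s c (x ∷ l) with ≡⊎≡not (s x) c | splitAtMin s c l
  ... | inj₂ p | L , R , e     , eq , bs , rs = x ∷ L , R , suc e , ≡.cong (x ∷_) eq , down p bs , rs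
  ... | inj₁ p | L , R , suc e , eq , bs , rs = x ∷ L , R , e , ≡.cong (x ∷_) eq , up p bs , rs
  -- The tail never goes below its own start, so after this step up the walk stays strictly above
  -- its beginning: the cut moves to the front.
  ... | inj₁ p | L , R , zero  , ≡.refl , bs , rs =
    [] , x ∷ l , 0 , ≡.refl , [] , p ∷ Ballot-++ bs (proj₂ (StrictBallot⇒Ballot rs))

  unzipAtMin : ∀ (s : I → Bool) c l →
    ∃[ L ] ∃[ R ] ∃[ e ] (l ≡ L ʳ++ R × Ballot s (not c) 0 L e × StrictBallot {s} c R)
  unzipAtMin s c l with splitAtMin s c l
  ... | L , R , e , eq , bs , rs =
    L ʳ++ [] , R , e , ≡.trans eq (≡.sym (ʳ++-ʳ++ L)) , Ballot-ʳ++ bs [] , rs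

-- Products over pairs, split at a cut

module PairProduct {c ℓ₁ ℓ₂} (ℝ : RealField c ℓ₁ ℓ₂) {I : Set} (X : I → I → RealField.Carrier ℝ) where
  open Inequalities ℝ

  row : I → List I → Carrier
  row x = prod (λ j → 1# - X x j)

  col : List I → I → Carrier
  col L y = prod (λ a → 1# - X a y) L

  rows : List I → List I → Carrier
  rows L m = prod (λ a → row a m) L

  pairs : List I → Carrier
  pairs []      = 1#
  pairs (x ∷ l) = row x l * pairs l

  revPairs : List I → Carrier
  revPairs []      = 1#
  revPairs (a ∷ L) = col L a * revPairs L

  rows-∷ : ∀ L a m → rows L (a ∷ m) ≈ col L a * rows L m
  rows-∷ L a m = sym (prod-* _ _ L)

  -- The factors are the pairs inside `L`, those across the cut and those inside `m`.
  pairs-ʳ++ : ∀ L {m} → pairs (L ʳ++ m) ≈ revPairs L * rows L m * pairs m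
  pairs-ʳ++ [] {m} = solve 1 (λ p → p := con (+ 1) :* con (+ 1) :* p) refl (pairs m)
  pairs-ʳ++ (a ∷ L) {m} = trans (pairs-ʳ++ L {a ∷ m}) (trans (*-congʳ (*-congˡ (rows-∷ L a m)))
    (solve 5 (λ p c r w q → p :* (c :* r) :* (w :* q) := (c :* p) :* (w :* r) :* q) refl
      (revPairs L) (col L a) (rows L m) (row a m) (pairs m)))

-- The bound for an abstract system of ratios

module PohstBound {c ℓ₁ ℓ₂} (ℝ : RealField c ℓ₁ ℓ₂) {I : Set} (s : I → Bool)
  (X : I → I → RealField.Carrier ℝ) (_≺_ : Rel I 0ℓ)
  (X-Unit : ∀ {i j} → i ≺ j → s i ≡ s j → Inequalities.Unit ℝ (X i j))
  (X-Neg : ∀ {i j} → i ≺ j → s i ≡ not (s j) → Inequalities.Neg ℝ (X i j))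
  (X-* : ∀ {i j k} → i ≺ j → j ≺ k → RealField._≈_ ℝ (X i k) (RealField._*_ ℝ (X i j) (X j k)))
  where
  open Inequalities ℝ
  open PairProduct ℝ X

  ConsecutiveRoots : List I → Set ℓ₁
  ConsecutiveRoots = Linked (λ i j → Root (X i j))

  -- Arbitrary lists are needed because a removal leaves a gap in the positions. The ratios are
  -- given by the multiplicative `X` and not as quotients, which would not exist when a coordinate
  -- is 0.
  Bound : List I → Set (ℓ₁ ⊔ ℓ₂)
  Bound l = Tight (pairs l) (2# ^ ⌊ length l /2⌋) (ConsecutiveRoots l)

  private
    opposite : ∀ {a b d} → a ≡ d → b ≡ not d → a ≡ not b
    opposite {d = d} ≡.refl ≡.refl = ≡.sym (not-involutive d)

    opposite′ : ∀ {a b d} → a ≡ not d → b ≡ d → a ≡ not b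
    opposite′ ≡.refl ≡.refl = ≡.refl

  module Right {d x ρ} (ρ-neg : Neg ρ) (sx : s x ≡ d) where
    open Sweep s d (X x) ρ-neg public

    inRange : ∀ {R} → All (x ≺_) R → All InRange R
    inRange = All.map λ x≺j →
      (λ sj → X-Unit x≺j (≡.trans sx (≡.sym sj))) , (λ sj → X-Neg x≺j (opposite sx sj))

    precedes : ∀ {R} → All (x ≺_) R → AllPairs _≺_ R → AllPairs Precedes R
    precedes [] [] = []
    precedes (x≺i ∷ x≺R) (i≺R ∷ R-sorted) =
      All.map (λ i≺j si sj → _ , X-Neg i≺j (opposite si sj) , X-* x≺i i≺j) i≺R
      ∷ precedes x≺R R-sorted

  module Left {d y ρ} (ρ-neg : Neg ρ) (sy : s y ≡ d) where
    open Sweep s d (λ a → X a y) ρ-neg public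

    inRange : ∀ {L} → All (_≺ y) L → All InRange L
    inRange = All.map λ a≺y →
      (λ sa → X-Unit a≺y (≡.trans sa (≡.sym sy))) , (λ sa → X-Neg a≺y (opposite′ sa sy))

    precedes : ∀ {L} → All (_≺ y) L → AllPairs (flip _≺_) L → AllPairs Precedes L
    precedes [] [] = []
    precedes (a≺y ∷ L≺y) (L≺a ∷ L-sorted) =
      All.map (λ b≺a sa sb → _ , X-Neg b≺a (opposite′ sb sa) , trans (X-* b≺a a≺y) (*-comm _ _)) L≺a
      ∷ precedes L≺y L-sorted

  -- For `ρ = 0#` the factor `g ρ τ` is just `1# - τ`, so the sweep designed for a pair also serves
  -- for a single position.
  remove-first : ∀ {d x R e} → s x ≡ d → Ballot s d 0 R e → AllPairs _≺_ (x ∷ R) → Bound R → Bound (x ∷ R)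
  remove-first {d} {x} {R} sx bs (x≺R ∷ R-sorted) bound =
    Tight-map (link R) (Tight-transˡ (≤-reflexive (*-congʳ row≈G))
      (Tight-transʳ (Tight-* (0≤prodG bs (inRange x≺R)) 0<1 (2^-pos ⌊ suc (length R) /2⌋)
          (sweep₀ bs (inRange x≺R) (precedes x≺R R-sorted))
          (Tight-transʳ bound (2^-mono (ℕ.⌊n/2⌋-mono (ℕ.n≤1+n (length R))))))
        (≤-reflexive (*-identityˡ _))))
    where
    open Right {d} {x} Neg-0 sx
    row≈G : row x R ≈ prod G R
    row≈G = prod-cong (All.universal (λ j → solve 1
      (λ t → con (+ 1) :- t := (con (+ 1) :- t) :* (con (+ 1) :- con (+ 0) :* t)) refl (X x j)) R)
    link : ∀ R → HeadRoot R × ConsecutiveRoots R → ConsecutiveRoots (x ∷ R)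
    link []      _         = [-]
    link (_ ∷ _) (q , qs) = q ∷ qs

  -- Taking `y` off the left walk leaves it credit 1, while the right walk has credit 0. So only the
  -- left sweep can leave a ratio `u`, and `[1-ρ]*g≤2` bounds its factor together with the factor
  -- `1# - ρ` of the pair.
  remove-pair : ∀ {d L y x R e e′} → s y ≡ not d → s x ≡ d →
    Ballot s (not d) 1 L e → Ballot s d 0 R e′ →
    AllPairs _≺_ (L ʳ++ (y ∷ x ∷ R)) → (AllPairs _≺_ (L ʳ++ R) → Bound (L ʳ++ R)) →
    Bound (L ʳ++ (y ∷ x ∷ R))
  remove-pair {d} {L} {y} {x} {R} sy sx ls rs sorted bound
    with ʳ++-AllPairs⁻ L sorted
  ... | L-sorted , cross , ((y≺x ∷ y≺R) ∷ x≺R ∷ R-sorted) =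
    Tight-map (λ ((roots , x-root) , qs) → link L R roots x-root qs)
      (Tight-transˡ (≤-reflexive factor) (Tight-transʳ
        (Tight-* 0≤cost 0<2 (2^-pos ⌊ length (L ʳ++ R) /2⌋) cost
          (bound (ʳ++-AllPairs⁺ L L-sorted (All.map (λ { (_ ∷ _ ∷ p) → p }) cross) R-sorted)))
        (≤-reflexive (reflexive (≡.cong (λ n → 2# ^ n) (≡.sym half))))))
    where
    ρ = X y x
    ρ-neg : Neg ρ
    ρ-neg = X-Neg y≺x (opposite′ sy sx)
    module ℒ = Left {not d} {y} ρ-neg sy
    module ℛ = Right {d} {x} ρ-neg sx
    L≺y = All.map All.head cross
    0≤GL = ℒ.0≤prodG ls (ℒ.inRange L≺y)
    0≤GR = ℛ.0≤prodG rs (ℛ.inRange x≺R)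

    0≤cost : 0# ≤ᴿ (1# - ρ) * (prod ℒ.G L * prod ℛ.G R)
    0≤cost = 0≤* (Neg⇒0≤1- ρ-neg) (0≤* 0≤GL 0≤GR)

    cost : Tight ((1# - ρ) * (prod ℒ.G L * prod ℛ.G R)) 2# ((Root ρ × ℒ.HeadRoot L) × ℛ.HeadRoot R)
    cost with ℒ.sweep₁ ls (ℒ.inRange L≺y) (ℒ.precedes L≺y L-sorted)
    ... | u , δ , u-neg , 0≤δ , GL≤ , δ-tight = Tight-map
      (λ (((ρ-root , u-root) , f) , r) → (ρ-root , f u-root) , r)
      (Tight-transˡ
        (≤-respʳ (solve 4 (λ r g δ h → r :* ((g :* δ) :* h) := (r :* g) :* δ :* h) refl
            (1# - ρ) (g ρ u) δ (prod ℛ.G R))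
          (*-mono-≤ (Neg⇒0≤1- ρ-neg) (0≤* (0≤* 0≤g 0≤δ) 0≤GR) ≤-refl
            (*-mono-≤ 0≤GL 0≤GR GL≤ ≤-refl)))
        (Tight-transʳ
          (Tight-* (0≤* 0≤[1-ρ]g 0≤δ) (*-pos 0<2 0<1) 0<1
            (Tight-* 0≤[1-ρ]g 0<2 0<1 ([1-ρ]*g≤2 ρ-neg u-neg) δ-tight)
            (ℛ.sweep₀ rs (ℛ.inRange x≺R) (ℛ.precedes x≺R R-sorted)))
          (≤-reflexive (trans (*-identityʳ _) (*-identityʳ _)))))
      where
      0≤g = 0≤g-Neg ρ-neg u-neg
      0≤[1-ρ]g = 0≤* (Neg⇒0≤1- ρ-neg) 0≤g

    half : ⌊ length (L ʳ++ (y ∷ x ∷ R)) /2⌋ ≡ suc ⌊ length (L ʳ++ R) /2⌋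
    half = ≡.cong ⌊_/2⌋ (length-ʳ++-∷∷ L)

    -- The ratio of `a` to `x` is its ratio to `y` times `ρ`, so the two factors involving `a`
    -- combine into one `g`.
    GL≈ : col L y * col L x ≈ prod ℒ.G L
    GL≈ = trans (prod-* _ _ L) (prod-cong (All.map
      (λ {a} a≺y → *-congˡ (+-congˡ (-‿cong (trans (X-* a≺y y≺x) (*-comm _ _))))) L≺y))

    GR≈ : row y R * row x R ≈ prod ℛ.G R
    GR≈ = trans (prod-* _ _ R) (prod-cong (All.map
      (λ {j} x≺j → trans (*-comm _ _) (*-congˡ (+-congˡ (-‿cong (X-* y≺x x≺j))))) x≺R))

    factor : pairs (L ʳ++ (y ∷ x ∷ R)) ≈ (1# - ρ) * (prod ℒ.G L * prod ℛ.G R) * pairs (L ʳ++ R)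
    factor = trans (pairs-ʳ++ L) (trans
      (*-congʳ (*-congˡ (trans (rows-∷ L y (x ∷ R)) (*-congˡ (rows-∷ L x R)))))
      (trans (solve 8 (λ p cy cx r ρ ry rx q →
          p :* (cy :* (cx :* r)) :* ((ρ :* ry) :* (rx :* q))
          := ρ :* ((cy :* cx) :* (ry :* rx)) :* (p :* r :* q)) refl
          (revPairs L) (col L y) (col L x) (rows L R) (1# - ρ) (row y R) (row x R) (pairs R))
        (*-cong (*-congˡ (*-cong GL≈ GR≈)) (sym (pairs-ʳ++ L)))))

    linkʳ : ∀ R → Root ρ → ℛ.HeadRoot R → ConsecutiveRoots R → ConsecutiveRoots (y ∷ x ∷ R)
    linkʳ []     ρ-root _      _  = ρ-root ∷ [-]
    linkʳ (_ ∷ _) ρ-root x-root qs = ρ-root ∷ x-root ∷ qs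

    link : ∀ L R → Root ρ × ℒ.HeadRoot L → ℛ.HeadRoot R → ConsecutiveRoots (L ʳ++ R) →
      ConsecutiveRoots (L ʳ++ (y ∷ x ∷ R))
    link []      R (ρ-root , _)      x-root qs = linkʳ R ρ-root x-root qs
    -- The link that joins `L` directly to `R` in the shortened list is discarded in favour of those
    -- through `y` and `x`.
    link (_ ∷ L) R (ρ-root , y-root) x-root qs = ʳ++-Linked-replace L qs
      (y-root ∷ linkʳ R ρ-root x-root (Linked.tail (ʳ++-Linked⁻ L qs)))

  -- The left walk starts with credit 0, so its first position can only go up: its sign is opposite
  -- to that of `x`.
  reduce : ∀ {n} → (∀ l → length l ℕ.≤ n → AllPairs _≺_ l → Bound l) →
    ∀ {d L x R e e′} → Ballot s (not d) 0 L e → s x ≡ d → Ballot s d 0 R e′ →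
    length (L ʳ++ (x ∷ R)) ℕ.≤ suc n → AllPairs _≺_ (L ʳ++ (x ∷ R)) → Bound (L ʳ++ (x ∷ R))
  reduce ih []         sx rs (s≤s len) sorted@(_ ∷ R-sorted) = remove-first sx rs sorted (ih _ len R-sorted)
  reduce ih {L = _ ∷ L} (up sy ls) sx rs len sorted = remove-pair {L = L} sy sx ls rs sorted
    (ih _ (ℕ.≤-trans (ℕ.n≤1+n _) (ℕ.s≤s⁻¹ (≡.subst (ℕ._≤ _) (length-ʳ++-∷∷ L) len))))

  bound : ∀ n l → length l ℕ.≤ n → AllPairs _≺_ l → Bound l
  bound n       []        _   _      = ≤-refl , λ _ → []
  bound (suc n) l@(_ ∷ _) len sorted with unzipAtMin s false l
  ... | L , x ∷ R , _ , eq , ls , sx ∷ rs = ≡.subst Bound (≡.sym eq)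
    (reduce (bound n) ls sx rs (≡.subst (λ l → length l ℕ.≤ _) eq len) (≡.subst (AllPairs _≺_) eq sorted))
  ... | L , [] , _ , eq , ls , [] with unzipAtMin s true l
  ...   | L′ , x ∷ R , _ , eq′ , ls′ , sx ∷ rs = ≡.subst Bound (≡.sym eq′)
    (reduce (bound n) ls′ sx rs (≡.subst (λ l → length l ℕ.≤ _) eq′ len) (≡.subst (AllPairs _≺_) eq′ sorted))
  -- If minimum and maximum were both last attained at the end, the final step would go down and up
  -- at once.
  ...   | L′ , [] , _ , eq′ , ls′ , [] = ⊥-elim (absurd ls ls′ eq
    (reverse-injective (≡.trans (≡.sym eq) eq′)))
    where
    absurd : ∀ {L L′ e e′} → Ballot s true 0 L e → Ballot s false 0 L′ e′ → l ≡ L ʳ++ [] → ¬ (L ≡ L′)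
    absurd []       _         ()
    absurd (up p _) (up p′ _) _ ≡.refl with () ← ≡.trans (≡.sym p) p′

-- The n + 1 positions around n coordinates, and their signs

positions : ℕ → List ℕ
positions zero    = 0 ∷ []
positions (suc n) = 0 ∷ map suc (positions n)

length-positions : ∀ n → length (positions n) ≡ suc n
length-positions zero    = ≡.refl
length-positions (suc n) = ≡.cong suc (≡.trans (length-map suc (positions n)) (length-positions n))

positions-sorted : ∀ n → AllPairs ℕ._<_ (positions n)
positions-sorted zero    = [] ∷ []
positions-sorted (suc n) = All.map⁺ (All.universal (λ _ → s≤s z≤n) (positions n))
  ∷ AllPairs.map⁺ (AllPairs.map s≤s (positions-sorted n))

⌊n/2⌋≡n/2 : ∀ n → ⌊ n /2⌋ ≡ n / 2
⌊n/2⌋≡n/2 zero          = ≡.refl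
⌊n/2⌋≡n/2 (suc zero)    = ≡.refl
⌊n/2⌋≡n/2 (suc (suc n)) = ≡.trans (≡.cong suc (⌊n/2⌋≡n/2 n))
  (≡.sym (m/n≡1+[m∸n]/n {suc (suc n)} {2} (s≤s (s≤s z≤n))))

does-suc≤?suc : ∀ {m n} (i : Fin m) (j : Fin n) →
  does (toℕ (suc i) ℕ.≤? toℕ (suc j)) ≡ does (toℕ i ℕ.≤? toℕ j)
does-suc≤?suc zero    j = ≡.refl
does-suc≤?suc (suc i) j = ≡.refl

-- The sign of x₀ ⋯ x_{i-1}, true being negative.
prefixSign : ∀ {n} → (Fin n → Bool) → ℕ → Bool
prefixSign {zero}  σ i       = false
prefixSign {suc n} σ zero    = false
prefixSign {suc n} σ (suc i) = σ zero xor prefixSign (σ ∘ suc) i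

-- From vectors in the cube to ratios of positions

module Cube {c ℓ₁ ℓ₂} (ℝ : RealField c ℓ₁ ℓ₂) where
  open Inequalities ℝ
  open PairProduct ℝ
  open Sum *-commutativeMonoid using (sum-cong-≋; sum-replicate-zero)

  -- The product of the coordinates k with i ≤ k < j.
  segment : ∀ {n} → Vector Carrier n → ℕ → ℕ → Carrier
  segment {zero}  v i       j       = 1#
  segment {suc n} v i       zero    = 1#
  segment {suc n} v zero    (suc j) = v zero * segment (tail v) zero j
  segment {suc n} v (suc i) (suc j) = segment (tail v) i j

  segment-zero : ∀ {n} (v : Vector Carrier n) i → segment v i zero ≈ 1#
  segment-zero {zero}  v i = refl
  segment-zero {suc n} v i = refl

  segment-* : ∀ {n} (v : Vector Carrier n) {i j k} → i ℕ.≤ j → j ℕ.≤ k →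
    segment v i k ≈ segment v i j * segment v j k
  segment-* {zero}  v _ _ = sym (*-identityˡ 1#)
  segment-* {suc n} v {zero} {zero} _ _ = sym (*-identityˡ _)
  segment-* {suc n} v {zero} {suc j} {suc k} z≤n (s≤s j≤k) =
    trans (*-congˡ (segment-* (tail v) z≤n j≤k)) (sym (*-assoc _ _ _))
  segment-* {suc n} v (s≤s i≤j) (s≤s j≤k) = segment-* (tail v) i≤j j≤k

  -- Both signs admit 0, so a vanishing coordinate may be given either one.
  HasSign : Bool → Carrier → Set ℓ₂
  HasSign false = Unit
  HasSign true  = Neg

  HasSign-* : ∀ a b {x y} → HasSign a x → HasSign b y → HasSign (a xor b) (x * y)
  HasSign-* false false = Unit*Unit
  HasSign-* false true  = Unit*Neg
  HasSign-* true  false = Neg*Unit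
  HasSign-* true  true  = Neg*Neg

  HasSign-segment₀ : ∀ {n} (v : Vector Carrier n) {σ} → (∀ i → HasSign (σ i) (v i)) →
    ∀ j → HasSign (prefixSign σ j) (segment v 0 j)
  HasSign-segment₀ {zero}  v h j       = Unit-1
  HasSign-segment₀ {suc n} v h zero    = Unit-1
  HasSign-segment₀ {suc n} v {σ} h (suc j) =
    HasSign-* (σ zero) _ (h zero) (HasSign-segment₀ (tail v) (h ∘ suc) j)

  -- The common prefix cancels: the sign of a segment depends only on whether the prefix signs at
  -- its two ends agree.
  HasSign-segment : ∀ {n} (v : Vector Carrier n) {σ} → (∀ i → HasSign (σ i) (v i)) →
    ∀ {i j} → i ℕ.≤ j → HasSign (prefixSign σ i xor prefixSign σ j) (segment v i j)
  HasSign-segment {zero}  v h _               = Unit-1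
  HasSign-segment {suc n} v h {zero} {j} _    = HasSign-segment₀ v h j
  HasSign-segment {suc n} v {σ} h {suc i} {suc j} (s≤s i≤j) =
    ≡.subst (λ b → HasSign b _) (≡.sym (xor-cancelˡ (σ zero) (prefixSign (σ ∘ suc) i) _))
      (HasSign-segment (tail v) (h ∘ suc) i≤j)
    where
    xor-cancelˡ : ∀ a b c → (a xor b) xor (a xor c) ≡ b xor c
    xor-cancelˡ false b c = ≡.refl
    xor-cancelˡ true  b c = xor-annihilates-not b c

  product-cong : ∀ n {t u : Vector Carrier n} → (∀ i → t i ≈ u i) → product t ≈ product u
  product-cong n = sum-cong-≋ {n}

  product-1 : ∀ n {t : Vector Carrier n} → (∀ i → t i ≈ 1#) → product t ≈ 1#
  product-1 n eq = trans (product-cong n eq) (sum-replicate-zero n)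

  prod-1 : ∀ {I : Set} {h : I → Carrier} → (∀ i → h i ≈ 1#) → ∀ l → prod h l ≈ 1#
  prod-1 eq []      = refl
  prod-1 eq (i ∷ l) = trans (*-cong (eq i) (prod-1 eq l)) (*-identityˡ 1#)

  prod-map : ∀ {I J : Set} (h : J → Carrier) (φ : I → J) l → prod h (map φ l) ≈ prod (h ∘ φ) l
  prod-map h φ []      = refl
  prod-map h φ (i ∷ l) = *-congˡ (prod-map h φ l)

  pairs-map : ∀ {I J : Set} (Y : J → J → Carrier) (φ : I → J) l →
    pairs Y (map φ l) ≈ pairs (λ i j → Y (φ i) (φ j)) l
  pairs-map Y φ []      = refl
  pairs-map Y φ (i ∷ l) = *-cong (prod-map _ φ l) (pairs-map Y φ l)

  product≈prod-positions : ∀ n {t : Vector Carrier (suc n)} {h} → (∀ i → t i ≈ h (toℕ i)) →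
    product t ≈ prod h (positions n)
  product≈prod-positions zero        eq = *-congʳ (eq zero)
  product≈prod-positions (suc n) {h = h} eq = *-cong (eq zero)
    (trans (product≈prod-positions n (eq ∘ suc)) (sym (prod-map h suc (positions n))))

  if-cong : ∀ {b b′ x y} → b ≡ b′ → x ≈ y → (if b then x else 1#) ≈ (if b′ then y else 1#)
  if-cong {true}  ≡.refl x≈y = x≈y
  if-cong {false} ≡.refl _   = refl

  segmentProduct-suc : ∀ {n} (v : Vector Carrier (suc n)) i j →
    segmentProduct ℝ v (suc i) (suc j) ≈ segmentProduct ℝ (tail v) i j
  segmentProduct-suc {n} v i j = trans (*-identityˡ _) (product-cong n λ k →
    if-cong (≡.cong₂ _∧_ (does-suc≤?suc i k) (does-suc≤?suc k j)) (refl {v (suc k)}))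

  segmentProduct-zero : ∀ {n} (v : Vector Carrier (suc n)) j →
    segmentProduct ℝ v zero j ≈ segment v 0 (suc (toℕ j))
  segmentProduct-zero {n} v zero = *-congˡ (trans (product-1 n λ k → refl) (sym (segment-zero (tail v) 0)))
  segmentProduct-zero {suc n} v (suc j) = *-congˡ (trans
    (product-cong (suc n) λ k → if-cong (does-suc≤?suc k j) (refl {v (suc k)}))
    (segmentProduct-zero (tail v) j))

  f-suc : ∀ {n} (v : Vector Carrier (suc n)) →
    f ℝ v ≈ row (segment v) 0 (map suc (positions n)) * f ℝ (tail v)
  f-suc {n} v = *-cong
    (trans (product≈prod-positions n {h = λ j → 1# - segment v 0 (suc j)}
        (λ j → +-congˡ (-‿cong (segmentProduct-zero v j))))
      (sym (prod-map _ suc (positions n))))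
    (product-cong n λ i → trans (*-identityˡ _) (product-cong n λ j →
      if-cong (does-suc≤?suc i j) (+-congˡ (-‿cong (segmentProduct-suc v i j)))))

  -- A closed interval of coordinates from i to j is the half-open one from i to j + 1, so the index
  -- pairs with i at most j become the pairs of distinct positions.
  f≈pairs : ∀ {n} (v : Vector Carrier n) → f ℝ v ≈ pairs (segment v) (positions n)
  f≈pairs {zero}  v = sym (*-identityˡ 1#)
  f≈pairs {suc n} v = trans (f-suc v) (*-congˡ (trans (f≈pairs (tail v))
    (sym (pairs-map (segment v) suc (positions n)))))

  consecutiveRoots⇒Root : ∀ {n} (v : Vector Carrier n) →
    Linked (λ i j → Root (segment v i j)) (positions n) → ∀ i → Root (v i)
  consecutiveRoots⇒Root {suc n} v qs (suc i) =
    consecutiveRoots⇒Root (tail v) (Linked.map⁻ (linkedTail qs)) i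
    where
    linkedTail : ∀ {Q : ℕ → ℕ → Set ℓ₁} {x l} → Linked Q (x ∷ l) → Linked Q l
    linkedTail [-]      = []
    linkedTail (_ ∷ qs) = qs
  consecutiveRoots⇒Root {suc zero}    v (q ∷ _) zero = Root-resp (*-identityʳ _) q
  consecutiveRoots⇒Root {suc (suc n)} v (q ∷ _) zero = Root-resp (*-identityʳ _) q

  f-bound-signed : ∀ {n} (v : Vector Carrier n) {σ} → (∀ i → HasSign (σ i) (v i)) →
    Tight (f ℝ v) (2# ^ ⌊ suc n /2⌋) (∀ i → Root (v i))
  f-bound-signed {n} v {σ} h = Tight-transˡ (≤-reflexive (f≈pairs v))
    (Tight-map (consecutiveRoots⇒Root v)
      (≡.subst (λ k → Tight (pairs (segment v) (positions n)) (2# ^ ⌊ k /2⌋)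
        (Linked (λ i j → Root (segment v i j)) (positions n))) (length-positions n)
        (bound _ (positions n) ℕ.≤-refl (positions-sorted n))))
    where
    s = prefixSign σ
    open PohstBound ℝ s (segment v) ℕ._<_
      (λ {i} {j} i<j eq → ≡.subst (λ b → HasSign b _)
        (≡.trans (≡.cong (_xor s j) eq) (xor-same (s j))) (HasSign-segment v h (ℕ.<⇒≤ i<j)))
      (λ {i} {j} i<j eq → ≡.subst (λ b → HasSign b _)
        (≡.trans (≡.cong (_xor s j) eq) (xor-inverseˡ (s j))) (HasSign-segment v h (ℕ.<⇒≤ i<j)))
      (λ i<j j<k → segment-* v (ℕ.<⇒≤ i<j) (ℕ.<⇒≤ j<k))

  ¬¬signs : ∀ {n} (v : Vector Carrier n) → InCube ℝ v → ¬ ¬ (∀ i → ∃[ b ] HasSign b (v i))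
  -- Double negation commutes with the quantifier because the index set is finite.
  ¬¬signs v cube = sequence (RawMonad.rawApplicative ¬¬-Monad) λ i k →
    ≤-total 0# (v i) (k ∘ [ nonneg i , nonpos i ]′)
    where
    nonneg : ∀ i → 0# ≤ᴿ v i → ∃[ b ] HasSign b (v i)
    nonneg i 0≤v = false , 0≤v , ≤⇒0≤- (proj₂ (cube i))
    nonpos : ∀ i → v i ≤ᴿ 0# → ∃[ b ] HasSign b (v i)
    nonpos i v≤0 = true , ≤-respʳ (+-identityˡ _) (≤⇒0≤- v≤0) ,
      ≤-respʳ (solve 1 (λ x → x :- (:- con (+ 1)) := con (+ 1) :+ x) refl (v i)) (≤⇒0≤- (proj₁ (cube i)))

  f-bound : ∀ {n} (v : Vector Carrier n) → InCube ℝ v →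
    Tight (f ℝ v) (2# ^ ⌊ suc n /2⌋) (∀ i → Root (v i))
  f-bound v cube =
    (λ 2^<f → ¬¬signs v cube λ h → proj₁ (f-bound-signed v {proj₁ ∘ h} (proj₂ ∘ h)) 2^<f) ,
    (λ eq i → ≈-stable λ ¬root → ¬¬signs v cube λ h →
      ¬root (proj₂ (f-bound-signed v {proj₁ ∘ h} (proj₂ ∘ h)) eq i))

  -- The vectors attaining the maximum

  Root⇒≈0⊎≈-1 : ∀ {x} → Root x → x ≈ 0# ⊎ x ≈ - 1#
  -- Cotransitivity decides which of the two factors `x` and `1# + x` is nonzero and can be
  -- cancelled.
  Root⇒≈0⊎≈-1 {x} root with <-cotrans x -1<0
  ... | inj₁ -1<x = inj₁ (*≈0-cancelʳ
    (<-respˡ-≈ (-‿inverseˡ 1#) (<-respʳ-≈ (+-comm _ _) (+-monoˡ-< 1# -1<x))) root)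
  ... | inj₂ x<0  = inj₂ (trans (solve 1 (λ x → x := con (+ 1) :+ x :- con (+ 1)) refl x)
      (trans (+-congʳ 1+x≈0) (+-identityˡ _)))
    where
    1+x≈0 : 1# + x ≈ 0#
    1+x≈0 = *≈0-cancelʳ (neg-positive x<0) (trans
      (solve 1 (λ x → (con (+ 1) :+ x) :* (:- x) := :- (x :* (con (+ 1) :+ x))) refl x)
      (trans (-‿cong root) (solve 0 (:- con (+ 0) := con (+ 0)) refl)))

  -1≉0 : ∀ {x} → x ≈ - 1# → ¬ (x ≈ 0#)
  -1≉0 x≈-1 x≈0 = <-irrefl (trans (sym x≈-1) x≈0) -1<0

  1-x*y≈1 : ∀ {x} y → x ≈ 0# → 1# - x * y ≈ 1#
  1-x*y≈1 y x≈0 = trans (+-congˡ (-‿cong (trans (*-congʳ x≈0) (zeroˡ y))))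
    (solve 0 (con (+ 1) :- con (+ 0) := con (+ 1)) refl)

  f-≈0∷ : ∀ {n} (v : Vector Carrier (suc n)) → v zero ≈ 0# → f ℝ v ≈ f ℝ (tail v)
  f-≈0∷ {n} v v₀≈0 = trans (f-suc v) (trans (*-congʳ (trans (prod-map _ suc (positions n))
    (prod-1 (λ j → 1-x*y≈1 _ v₀≈0) (positions n)))) (*-identityˡ _))

  -- Of the segments starting at the first coordinate, the shortest gives the factor 2 and all
  -- others contain the second coordinate, which is 0. The hypothesis is phrased by index so that it
  -- also covers vectors of length 1.
  f-≈-1∷ : ∀ {n} (v : Vector Carrier (suc n)) → v zero ≈ - 1# →
    (∀ i → toℕ i ≡ 1 → v i ≈ 0#) → f ℝ v ≈ 2# * f ℝ (tail v)
  f-≈-1∷ {zero} v v₀≈-1 _ = trans (f-suc v) (*-congʳ (trans (*-identityʳ _)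
    (trans (+-congˡ (-‿cong (*-congʳ v₀≈-1)))
      (solve 0 (con (+ 1) :- (:- con (+ 1)) :* con (+ 1) := con (+ 2)) refl))))
  f-≈-1∷ {suc n} v v₀≈-1 v₁≈0 = trans (f-suc v) (*-congʳ (trans
    (*-cong
      (trans (+-congˡ (-‿cong (*-congʳ v₀≈-1)))
        (solve 0 (con (+ 1) :- (:- con (+ 1)) :* con (+ 1) := con (+ 2)) refl))
      (trans (prod-map _ suc (map suc (positions n))) (trans (prod-map _ suc (positions n))
        (prod-1 (λ j → trans
          (+-congˡ (-‿cong (sym (*-assoc _ _ _))))
          (1-x*y≈1 _ (trans (*-congˡ (v₁≈0 (suc zero) ≡.refl)) (zeroʳ _)))) (positions n)))))
    (*-identityʳ _)))

  -- The segment formed by the two coordinates has product 1, so its factor vanishes.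
  f-consecutive : ∀ {n} (v : Vector Carrier n) i j → toℕ j ≡ suc (toℕ i) →
    v i ≈ - 1# → v j ≈ - 1# → f ℝ v ≈ 0#
  f-consecutive {suc n} v (suc i) (suc j) eq vi vj = trans (f-suc v)
    (trans (*-congˡ (f-consecutive (tail v) i j (ℕ.suc-injective eq) vi vj)) (zeroʳ _))
  f-consecutive {suc (suc n)} v zero (suc zero) eq v₀ v₁ = trans (f-suc v) (trans
    (*-congʳ (trans
      (*-congˡ (trans (prod-map _ suc (map suc (positions n))) (trans (prod-map _ suc (positions n)) (hd n))))
      (zeroʳ _))) (zeroˡ _))
    where
    factor≈0 : 1# - v zero * (v (suc zero) * segment (tail (tail v)) 0 0) ≈ 0#
    factor≈0 = trans (+-congˡ (-‿cong (*-cong v₀ (*-cong v₁ (segment-zero (tail (tail v)) 0)))))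
      (solve 0 (con (+ 1) :- (:- con (+ 1)) :* ((:- con (+ 1)) :* con (+ 1)) := con (+ 0)) refl)
    hd : ∀ m → prod (λ j → 1# - segment v 0 (suc (suc j))) (positions m) ≈ 0#
    hd zero    = trans (*-congʳ factor≈0) (zeroˡ _)
    hd (suc m) = trans (*-congʳ factor≈0) (zeroˡ _)

  Marks : ∀ {n} → Vector Carrier n → Subset n → Set ℓ₁
  Marks v S = ∀ i → (i ∈ S) ⇔ (v i ≈ - 1#)

  Marks-tail : ∀ {n} {v : Vector Carrier (suc n)} {b S} → Marks v (b ∷ S) → Marks (tail v) S
  Marks-tail S⇔ i = mk⇔ (Equivalence.to (S⇔ (suc i)) ∘ there)
    (λ v≈-1 → case-there (Equivalence.from (S⇔ (suc i)) v≈-1))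
    where
    case-there : ∀ {b S} → suc i ∈ (b ∷ S) → i ∈ S
    case-there (there i∈S) = i∈S

  marks : ∀ {n} (v : Vector Carrier n) → ZeroOrMinusOne ℝ v → ∃[ S ] Marks v S
  marks {zero}  v z = [] , λ ()
  marks {suc n} v z with z zero | marks (tail v) (z ∘ suc)
  ... | inj₁ v₀≈0  | S , S⇔ = outside ∷ S , λ where
    zero    → mk⇔ (λ ()) (λ v₀≈-1 → contradiction v₀≈0 (-1≉0 v₀≈-1))
    (suc i) → mk⇔ (λ { (there i∈S) → Equivalence.to (S⇔ i) i∈S }) (there ∘ Equivalence.from (S⇔ i))
  ... | inj₂ v₀≈-1 | S , S⇔ = inside ∷ S , λ where
    zero    → mk⇔ (λ _ → v₀≈-1) (λ _ → here)
    (suc i) → mk⇔ (λ { (there i∈S) → Equivalence.to (S⇔ i) i∈S }) (there ∘ Equivalence.from (S⇔ i))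

  f≈2^ : ∀ {n} (v : Vector Carrier n) → ZeroOrMinusOne ℝ v → NoConsecutiveMinusOnes ℝ v →
    ∀ S → Marks v S → f ℝ v ≈ 2# ^ ∣ S ∣
  f≈2^ {zero}  v z nc []            S⇔ = refl
  f≈2^ {suc n} v z nc (outside ∷ S) S⇔ = trans (f-≈0∷ v v₀≈0)
    (f≈2^ (tail v) (z ∘ suc) (λ i j eq → nc (suc i) (suc j) (≡.cong suc eq)) S (Marks-tail S⇔))
    where
    v₀≈0 : v zero ≈ 0#
    v₀≈0 with z zero
    ... | inj₁ v₀≈0  = v₀≈0
    ... | inj₂ v₀≈-1 with () ← Equivalence.from (S⇔ zero) v₀≈-1
  f≈2^ {suc n} v z nc (inside ∷ S) S⇔ = trans (f-≈-1∷ v v₀≈-1 v₁≈0)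
    (*-congˡ (f≈2^ (tail v) (z ∘ suc) (λ i j eq → nc (suc i) (suc j) (≡.cong suc eq)) S (Marks-tail S⇔)))
    where
    v₀≈-1 : v zero ≈ - 1#
    v₀≈-1 = Equivalence.to (S⇔ zero) here
    v₁≈0 : ∀ i → toℕ i ≡ 1 → v i ≈ 0#
    v₁≈0 i eq with z i
    ... | inj₁ vᵢ≈0  = vᵢ≈0
    ... | inj₂ vᵢ≈-1 = contradiction (v₀≈-1 , vᵢ≈-1) (nc zero i eq)

  ZeroOrMinusOne⇒InCube : ∀ {n} {v : Vector Carrier n} → ZeroOrMinusOne ℝ v → InCube ℝ v
  ZeroOrMinusOne⇒InCube z i with z i
  ... | inj₁ v≈0  = ≤-respʳ (sym v≈0) (<⇒≤ -1<0) , ≤-respˡ (sym v≈0) 0≤1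
  ... | inj₂ v≈-1 = ≤-reflexive (sym v≈-1) , ≤-respˡ (sym v≈-1) (≤-trans (<⇒≤ -1<0) 0≤1)

  -- A competitor attaining the bound; it shows that the greatest possible count is at least
  -- `⌊ suc n /2⌋`.
  alternating : ∀ n → Vector Carrier n
  alternating (suc n)       zero          = - 1#
  alternating (suc (suc n)) (suc zero)    = 0#
  alternating (suc (suc n)) (suc (suc i)) = alternating n i

  alternating-ZeroOrMinusOne : ∀ n → ZeroOrMinusOne ℝ (alternating n)
  alternating-ZeroOrMinusOne (suc n)       zero          = inj₂ refl
  alternating-ZeroOrMinusOne (suc (suc n)) (suc zero)    = inj₁ refl
  alternating-ZeroOrMinusOne (suc (suc n)) (suc (suc i)) = alternating-ZeroOrMinusOne n i

  alternating-NoConsecutive : ∀ n → NoConsecutiveMinusOnes ℝ (alternating n)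
  alternating-NoConsecutive (suc (suc n)) zero          (suc zero)    eq (_ , 0≈-1) = -1≉0 0≈-1 refl
  alternating-NoConsecutive (suc (suc n)) (suc zero)    j             eq (0≈-1 , _) = -1≉0 0≈-1 refl
  alternating-NoConsecutive (suc (suc n)) (suc (suc i)) (suc (suc j)) eq =
    alternating-NoConsecutive n i j (ℕ.suc-injective (ℕ.suc-injective eq))

  alternating-count : ∀ n → MinusOneCount ℝ (alternating n) ⌊ suc n /2⌋
  alternating-count zero       = [] , (λ ()) , ≡.refl
  alternating-count (suc zero) = inside ∷ [] , (λ { zero → mk⇔ (λ _ → refl) (λ _ → here) }) , ≡.refl
  alternating-count (suc (suc n)) with alternating-count n
  ... | S , S⇔ , eq = inside ∷ outside ∷ S , (λ where
      zero          → mk⇔ (λ _ → refl) (λ _ → here)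
      (suc zero)    → mk⇔ (λ { (there ()) }) (λ 0≈-1 → contradiction refl (-1≉0 0≈-1))
      (suc (suc i)) → mk⇔ (λ { (there (there i∈S)) → Equivalence.to (S⇔ i) i∈S })
        (there ∘ there ∘ Equivalence.from (S⇔ i))) , ≡.cong suc eq

  maximum⇔ : ∀ {n} (v : Vector Carrier n) → InCube ℝ v →
    (f ℝ v ≈ 2# ^ ⌊ suc n /2⌋) ⇔
    (ZeroOrMinusOne ℝ v × NoConsecutiveMinusOnes ℝ v × HasMostMinusOnes ℝ v)
  maximum⇔ {n} v cube = mk⇔ to from
    where
    to : f ℝ v ≈ 2# ^ ⌊ suc n /2⌋ → ZeroOrMinusOne ℝ v × NoConsecutiveMinusOnes ℝ v × HasMostMinusOnes ℝ v
    to eq = z , nc , ∣ S ∣ , (S , S⇔ , ≡.refl) , most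
      where
      z : ZeroOrMinusOne ℝ v
      z i = Root⇒≈0⊎≈-1 (proj₂ (f-bound v cube) eq i)
      nc : NoConsecutiveMinusOnes ℝ v
      nc i j j≡1+i (vi , vj) = <-irrefl
        (trans (sym (f-consecutive v i j j≡1+i vi vj)) eq) (2^-pos ⌊ suc n /2⌋)
      S = proj₁ (marks v z)
      S⇔ = proj₂ (marks v z)
      most : ∀ w k → ZeroOrMinusOne ℝ w → NoConsecutiveMinusOnes ℝ w → MinusOneCount ℝ w k → k ℕ.≤ ∣ S ∣
      -- The bound applied to `w` replaces counting: `f ℝ w` is `2# ^ ∣ T ∣`, and it cannot exceed
      -- the maximum, here equal to `2# ^ ∣ S ∣`.
      most w _ wz wnc (T , T⇔ , ≡.refl) = 2^-cancel-≤ {∣ T ∣} {∣ S ∣}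
        (≤-respˡ (f≈2^ w wz wnc T T⇔) (≤-respʳ (trans (sym eq) (f≈2^ v z nc S S⇔))
          (proj₁ (f-bound w (ZeroOrMinusOne⇒InCube wz)))))
    from : ZeroOrMinusOne ℝ v × NoConsecutiveMinusOnes ℝ v × HasMostMinusOnes ℝ v → f ℝ v ≈ 2# ^ ⌊ suc n /2⌋
    -- Comparison with `alternating n` gives `⌊ suc n /2⌋ ≤ ∣ S ∣`, hence the missing lower bound on
    -- `f ℝ v`.
    from (z , nc , .(∣ S ∣) , (S , S⇔ , ≡.refl) , most) = ≤-antisym (proj₁ (f-bound v cube))
      (≤-respʳ (sym (f≈2^ v z nc S S⇔)) (2^-mono
        (most (alternating n) _ (alternating-ZeroOrMinusOne n) (alternating-NoConsecutive n)
          (alternating-count n))))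

mainTheorem1 : ∀ {c ℓ₁ ℓ₂} (ℝ : RealField c ℓ₁ ℓ₂) → let open RealField ℝ in
    (n : ℕ) → 1 ℕ.≤ n → (v : Vector Carrier n) → InCube ℝ v →
    (f ℝ v ≤ᴿ (1# + 1#) ^ ((n ℕ.+ 1) / 2))
    × ((f ℝ v ≈ (1# + 1#) ^ ((n ℕ.+ 1) / 2))
    ⇔ (ZeroOrMinusOne ℝ v × NoConsecutiveMinusOnes ℝ v × HasMostMinusOnes ℝ v))
mainTheorem1 ℝ n _ v cube = ≡.subst
  (λ k → (f ℝ v ≤ᴿ 2# ^ k) × ((f ℝ v ≈ 2# ^ k)
    ⇔ (ZeroOrMinusOne ℝ v × NoConsecutiveMinusOnes ℝ v × HasMostMinusOnes ℝ v)))
  (≡.trans (⌊n/2⌋≡n/2 (suc n)) (≡.cong (_/ 2) (ℕ.+-comm 1 n)))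
  (proj₁ (f-bound v cube) , maximum⇔ v cube)
  where
  open Inequalities ℝ
  open Cube ℝ
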